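{- Let $\mathcal{V}$ be the infinite $3$-graph with vertex set $\{a_i,b_i,c_i:i\in\mathbb{N}\}$ (all distinct) and edge set $\{a_ib_jc_k:i\leq j\}$, and let $\mathcal{H}_{\mathcal{V}}$ be the class of all finite $3$-graphs isomorphic to an induced sub-$3$-graph of $\mathcal{V}$. Then $\mathcal{H}_{\mathcal{V}}$ is far from slicewise stable (i.e. there is no slicewise stable hereditary $3$-graph property $\mathcal{H}'$ with $\mathcal{H}_{\mathcal{V}}\sim\mathcal{H}'$), but $\mathcal{H}_{\mathcal{V}}$ admits binary $\mathrm{vdisc}_3$-error.
   Context: For distinct $x,y,z$ write $xy=\{x,y\}$, $xyz=\{x,y,z\}$; $K_3[X,Y,Z]=\{xyz:x\in X,y\in Y,z\in Z\text{ pairwise distinct}\}$. A $3$-graph is a pair $H=(V,F)$ with $F\subseteq\binom V3$. A hereditary $3$-graph property is a class of finite $3$-graphs closed under isomorphism and induced sub-$3$-graphs. An equipartition is a partition whose parts differ in size by at most $1$. A $3$-graph $H=(V,F)$ is slicewise $k$-stable if there do not exist $a,b_1,\dots,b_k,c_1,\dots,c_k\in V$ such that for all $i,j\in\{1,\dots,k\}$, $\{a,b_i,c_j\}\in F$ if and only if $i\leq j$. A hereditary $3$-graph property is slicewise stable if there is $k$ such that each of its members is slicewise $k$-stable. Two $3$-graphs $(V,F),(V,F')$ on the same vertex set are $\delta$-close if $|F\Delta F'|\leq\delta|V|^3$. $\mathcal{H}$ is close to $\mathcal{H}'$ if for all $\delta>0$ there is $N$ such that every $G\in\mathcal{H}$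 on at least $N$ vertices is $\delta$-close to some element of $\mathcal{H}'$ with the same vertex set. $\mathcal{H}\sim\mathcal{H}'$ means $\mathcal{H}$ is close to $\mathcal{H}'$ and $\mathcal{H}'$ is close to $\mathcal{H}$. A $3$-partite $3$-graph $(U\cup V\cup W,F)$ with $|F|=d|U||V||W|$ has $\mathrm{vdisc}_3(\epsilon)$ if for all $U'\subseteq U$, $V'\subseteq V$, $W'\subseteq W$, $\big||F\cap K_3[U',V',W']|-d|U'||V'||W'|\big|\leq\epsilon|U||V||W|$. $\mathcal{H}$ admits binary $\mathrm{vdisc}_3$-error if for all $\epsilon>0$ and $t_0\geq1$ there are $T,N$ such that for every $H=(V,F)\in\mathcal{H}$ with $|V|\geq N$ there are an equipartition $\mathcal{P}$ of $V$ into $t$ parts, $t_0\leq t\leq T$, and a set $\Sigma\subseteq\binom{\mathcal{P}}{2}$ with $|\Sigma|\leq\epsilon t^2$ such that for every three distinct parts $X,Y,Z\in\mathcal{P}$ with $XY,YZ,XZ\notin\Sigma$, the $3$-graph $(X\cup Y\cup Z,F\cap K_3[X,Y,Z])$ has $\mathrm{vdisc}_3(\epsilon)$. -}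

module Defs where

open import Level using (Level; 0ℓ) renaming (suc to lsuc)
open import Data.Bool using (Bool; false; T; if_then_else_; _∧_; _∨_; _xor_; not)
open import Data.Bool.Properties using (∧-zeroʳ)
open import Data.Bool.Solver using (module ∨-∧-Solver)
open import Data.Nat as ℕ using (ℕ; _≤ᵇ_; _^_)
open import Data.Nat.Properties using (+-0-commutativeMonoid)
open import Data.Fin as Fin using (Fin)
open import Data.Fin.Properties using (_≟_)
open import Data.Fin.Subset using (Subset; _∈_; _⊆_; Nonempty; Empty; ∣_∣) renaming (_∩_ to _∩ˢ_)
open import Data.Vec using (lookup)
open import Data.Integer using (+_)
open import Data.Rational as ℚ using (ℚ; 0ℚ)
open import Data.Product using (Σ; ∃-syntax; ∃₂; _×_; _,_)
open import Function.Bundles using (_⇔_; _↣_; module Injection)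
open import Function.Construct.Composition using (injection)
open import Relation.Nullary using (¬_; does; yes; no; contradiction)
open import Relation.Binary.PropositionalEquality using (_≡_; _≢_; refl; trans; cong₂)
open import Algebra.Properties.CommutativeMonoid.Sum +-0-commutativeMonoid using (sum)

private
  variable
    ℓ ℓ′ : Level
    m n t : ℕ
    V W : Set

ℕ→ℚ : ℕ → ℚ
ℕ→ℚ k = + k ℚ./ 1

𝟙 : Bool → ℕ
𝟙 p = if p then 1 else 0

-- {x, y, z} is an edge iff edge x y z ≡ true.  Together with the two symmetries,
-- edge-xxz makes every edge consist of three distinct vertices.
record ThreeGraph (V : Set) : Set where
  field
    edge     : V → V → V → Bool
    edge-12  : ∀ x y z → edge x y z ≡ edge y x z
    edge-23  : ∀ x y z → edge x y z ≡ edge x z y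
    edge-xxz : ∀ x z → edge x x z ≡ false

open ThreeGraph public

-- Each 3-subset of the vertex set is counted once, in its increasing enumeration.
∥_∥ : ThreeGraph (Fin n) → ℕ
∥ G ∥ = sum λ x → sum λ y → sum λ z →
  𝟙 (does (x Fin.<? y) ∧ does (y Fin.<? z) ∧ edge G x y z)

_∩_ : ThreeGraph V → ThreeGraph V → ThreeGraph V
(G ∩ H) .edge x y z   = edge G x y z ∧ edge H x y z
(G ∩ H) .edge-12 x y z = cong₂ _∧_ (edge-12 G x y z) (edge-12 H x y z)
(G ∩ H) .edge-23 x y z = cong₂ _∧_ (edge-23 G x y z) (edge-23 H x y z)
(G ∩ H) .edge-xxz x z  = cong₂ _∧_ (edge-xxz G x z) (edge-xxz H x z)

_△_ : ThreeGraph V → ThreeGraph V → ThreeGraph V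
(G △ H) .edge x y z   = edge G x y z xor edge H x y z
(G △ H) .edge-12 x y z = cong₂ _xor_ (edge-12 G x y z) (edge-12 H x y z)
(G △ H) .edge-23 x y z = cong₂ _xor_ (edge-23 G x y z) (edge-23 H x y z)
(G △ H) .edge-xxz x z  = cong₂ _xor_ (edge-xxz G x z) (edge-xxz H x z)

-- The 3-graph with edge set { {x, y, z} : f x y z }.
module _ (f : V → V → V → Bool)
         (f-xxz : ∀ x z → f x x z ≡ false)
         (f-xzx : ∀ x z → f x z x ≡ false)
         (f-zxx : ∀ x z → f z x x ≡ false) where

  private
    swap₁ : ∀ p q r s u v → p ∨ q ∨ r ∨ s ∨ u ∨ v ≡ r ∨ s ∨ p ∨ q ∨ v ∨ u
    swap₁ = solve 6 (λ p q r s u v → p :+ (q :+ (r :+ (s :+ (u :+ v))))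
                                  := r :+ (s :+ (p :+ (q :+ (v :+ u))))) refl
      where open ∨-∧-Solver

    swap₂ : ∀ p q r s u v → p ∨ q ∨ r ∨ s ∨ u ∨ v ≡ q ∨ p ∨ u ∨ v ∨ r ∨ s
    swap₂ = solve 6 (λ p q r s u v → p :+ (q :+ (r :+ (s :+ (u :+ v))))
                                  := q :+ (p :+ (u :+ (v :+ (r :+ s))))) refl
      where open ∨-∧-Solver

  fromTriples : ThreeGraph V
  fromTriples .edge x y z =
    f x y z ∨ f x z y ∨ f y x z ∨ f y z x ∨ f z x y ∨ f z y x
  fromTriples .edge-12 x y z =
    swap₁ (f x y z) (f x z y) (f y x z) (f y z x) (f z x y) (f z y x)
  fromTriples .edge-23 x y z =
    swap₂ (f x y z) (f x z y) (f y x z) (f y z x) (f z x y) (f z y x)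
  fromTriples .edge-xxz x z
    rewrite f-xxz x z | f-xzx x z | f-zxx x z = refl

_≠ᵇ_ : Fin n → Fin n → Bool
x ≠ᵇ y = not (does (x ≟ y))

≠ᵇ-irrefl : (x : Fin n) → x ≠ᵇ x ≡ false
≠ᵇ-irrefl x with x ≟ x
... | yes _  = refl
... | no x≢x = contradiction refl x≢x

inK₃ : Subset n → Subset n → Subset n → Fin n → Fin n → Fin n → Bool
inK₃ X Y Z x y z =
  (x ≠ᵇ y ∧ y ≠ᵇ z ∧ x ≠ᵇ z) ∧ lookup X x ∧ lookup Y y ∧ lookup Z z

-- K₃[X,Y,Z], as a 3-graph on the ambient vertex set.
K₃ : Subset n → Subset n → Subset n → ThreeGraph (Fin n)
K₃ X Y Z = fromTriples (inK₃ X Y Z) xxz xzx zxx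
  where
  xxz : ∀ x z → inK₃ X Y Z x x z ≡ false
  xxz x z rewrite ≠ᵇ-irrefl x = refl
  xzx : ∀ x z → inK₃ X Y Z x z x ≡ false
  xzx x z rewrite ≠ᵇ-irrefl x | ∧-zeroʳ (z ≠ᵇ x) | ∧-zeroʳ (x ≠ᵇ z) = refl
  zxx : ∀ x z → inK₃ X Y Z z x x ≡ false
  zxx x z rewrite ≠ᵇ-irrefl x | ∧-zeroʳ (z ≠ᵇ x) = refl

-- G is isomorphic to an induced sub-3-graph of H.
_↪_ : ThreeGraph V → ThreeGraph W → Set
_↪_ {V} {W} G H = Σ (V ↣ W) λ f → let open Injection f in
  ∀ x y z → edge G x y z ≡ edge H (to x) (to y) (to z)

-- Every finite 3-graph is isomorphic to one on some Fin n, so an isomorphism-closed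
-- class is given by its members on these vertex sets.  Closure under _↪_ is closure
-- under isomorphism (a surjective embedding) and under induced sub-3-graphs.
record HereditaryProperty ℓ : Set (lsuc ℓ) where
  field
    member     : ThreeGraph (Fin n) → Set ℓ
    hereditary : {G : ThreeGraph (Fin m)} {H : ThreeGraph (Fin n)} →
                 G ↪ H → member H → member G

open HereditaryProperty public

SlicewiseStableGraph : ℕ → ThreeGraph V → Set
SlicewiseStableGraph {V} k G =
  ¬ (Σ V λ a → Σ (Fin k → V) λ b → Σ (Fin k → V) λ c →
       ∀ (i j : Fin k) → T (edge G a (b i) (c j)) ⇔ i Fin.≤ j)

SlicewiseStable : HereditaryProperty ℓ → Set ℓ
SlicewiseStable ℋ =
  ∃[ k ] (∀ {n} (G : ThreeGraph (Fin n)) → member ℋ G → SlicewiseStableGraph k G)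

Close : ℚ → ThreeGraph (Fin n) → ThreeGraph (Fin n) → Set
Close {n} δ G G′ = ℕ→ℚ ∥ G △ G′ ∥ ℚ.≤ δ ℚ.* ℕ→ℚ (n ^ 3)

_CloseTo_ : HereditaryProperty ℓ → HereditaryProperty ℓ′ → Set _
ℋ CloseTo ℋ′ = ∀ (δ : ℚ) → 0ℚ ℚ.< δ → ∃[ N ]
  (∀ {n} (G : ThreeGraph (Fin n)) → member ℋ G → N ℕ.≤ n →
   Σ (ThreeGraph (Fin n)) λ G′ → member ℋ′ G′ × Close δ G G′)

_∼_ : HereditaryProperty ℓ → HereditaryProperty ℓ′ → Set _
ℋ ∼ ℋ′ = ℋ CloseTo ℋ′ × ℋ′ CloseTo ℋ

FarFromSlicewiseStable : ∀ ℓ′ → HereditaryProperty ℓ → Set _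
FarFromSlicewiseStable ℓ′ ℋ =
  ¬ (Σ (HereditaryProperty ℓ′) λ ℋ′ → SlicewiseStable ℋ′ × ℋ ∼ ℋ′)

-- For a 3-partite 3-graph G with (disjoint) parts U, V, W.  Only the edges of G
-- matter, so G may live on a vertex set larger than U ∪ V ∪ W.
Vdisc₃ : ℚ → (U V W : Subset n) → ThreeGraph (Fin n) → Set
Vdisc₃ ε U V W G = Σ ℚ λ d →
  ℕ→ℚ ∥ G ∥ ≡ d ℚ.* vol U V W ×
  (∀ U′ V′ W′ → U′ ⊆ U → V′ ⊆ V → W′ ⊆ W →
   ℚ.∣ ℕ→ℚ ∥ G ∩ K₃ U′ V′ W′ ∥ ℚ.- d ℚ.* vol U′ V′ W′ ∣ ℚ.≤ ε ℚ.* vol U V W)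
  where
  vol : Subset _ → Subset _ → Subset _ → ℚ
  vol A B C = ℕ→ℚ (∣ A ∣ ℕ.* ∣ B ∣ ℕ.* ∣ C ∣)

record Equipartition (n t : ℕ) : Set where
  field
    part     : Fin t → Subset n
    nonempty : ∀ i → Nonempty (part i)
    disjoint : ∀ {i j} → i ≢ j → Empty (part i ∩ˢ part j)
    cover    : ∀ v → ∃[ i ] v ∈ part i
    balanced : ∀ i j → ∣ part i ∣ ℕ.≤ ℕ.suc ∣ part j ∣

open Equipartition public

-- A set of 2-element subsets of V.
record PairSet (V : Set) : Set where
  field
    pair        : V → V → Bool
    pair-sym    : ∀ x y → pair x y ≡ pair y x
    pair-irrefl : ∀ x → pair x x ≡ false

open PairSet public

∥_∥₂ : PairSet (Fin t) → ℕ
∥ S ∥₂ = sum λ x → sum λ y → 𝟙 (does (x Fin.<? y) ∧ pair S x y)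

-- The parts of a partition are referred to by their indices in Fin t.
AdmitsBinaryVdisc₃Error : HereditaryProperty ℓ → Set ℓ
AdmitsBinaryVdisc₃Error ℋ =
  ∀ (ε : ℚ) → 0ℚ ℚ.< ε → ∀ (t₀ : ℕ) → 1 ℕ.≤ t₀ →
  ∃₂ λ (T₀ N : ℕ) →
  ∀ {n} (H : ThreeGraph (Fin n)) → member ℋ H → N ℕ.≤ n →
  Σ ℕ λ t → t₀ ℕ.≤ t × t ℕ.≤ T₀ ×
  Σ (Equipartition n t) λ P → Σ (PairSet (Fin t)) λ S →
  ℕ→ℚ ∥ S ∥₂ ℚ.≤ ε ℚ.* ℕ→ℚ (t ^ 2) ×
  (∀ x y z → x ≢ y → y ≢ z → x ≢ z →
   pair S x y ≡ false → pair S y z ≡ false → pair S x z ≡ false →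
   let X = part P x ; Y = part P y ; Z = part P z in
   Vdisc₃ ε X Y Z (H ∩ K₃ X Y Z))

data 𝒱-Vertex : Set where
  a[_] b[_] c[_] : ℕ → 𝒱-Vertex

inc : 𝒱-Vertex → 𝒱-Vertex → 𝒱-Vertex → Bool
inc a[ i ] b[ j ] c[ k ] = i ≤ᵇ j
inc _      _      _      = false

𝒱 : ThreeGraph 𝒱-Vertex
𝒱 = fromTriples inc xxz xzx zxx
  where
  xxz : ∀ x z → inc x x z ≡ false
  xxz a[ _ ] z = refl
  xxz b[ _ ] z = refl
  xxz c[ _ ] z = refl
  xzx : ∀ x z → inc x z x ≡ false
  xzx a[ _ ] a[ _ ] = refl
  xzx a[ _ ] b[ _ ] = refl
  xzx a[ _ ] c[ _ ] = refl
  xzx b[ _ ] z = refl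
  xzx c[ _ ] z = refl
  zxx : ∀ x z → inc z x x ≡ false
  zxx a[ _ ] a[ _ ] = refl
  zxx b[ _ ] a[ _ ] = refl
  zxx c[ _ ] a[ _ ] = refl
  zxx x b[ _ ] = refl
  zxx x c[ _ ] = refl

ℋ𝒱 : HereditaryProperty 0ℓ
ℋ𝒱 .member G = G ↪ 𝒱
ℋ𝒱 .hereditary (f , f-edge) (g , g-edge) =
  injection f g ,
  λ x y z → trans (f-edge x y z) (g-edge (to f x) (to f y) (to f z))
  where open Injection using (to)

{-# OPTIONS --safe #-}

-- Far from slicewise stable: in the sub-3-graph of 𝒱 on the first 2kL vertices a_i, the first
-- 2kL vertices b_j and L vertices c_l, cut the a's and the b's into 2k consecutive blocks of
-- length L.  For each (s, t, l), taking the s-th vertex of every even block of a's and the t-th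
-- vertex of every odd block of b's gives a half graph of size k in the slice at c_l.  The triples
-- involved for different (s, t, l) are disjoint and a slicewise k-stable 3-graph must differ from
-- 𝒱 on at least one triple for each (s, t, l), hence on at least L³ triples out of O(L³).
--
-- Binary vdisc₃-error: order the vertices as a's, b's, c's, each class by index, and cut into t
-- consecutive intervals.  At most two intervals meet more than one class.  A pair of intervals
-- p of a's and q of b's is not homogeneous for i ≤ j only if their index ranges interleave; such
-- pairs form a staircase, so there are at most 2t of them.  Once these O(t) pairs are put in Σ,
-- every remaining triple of parts spans all or none of its transversal triples.
module Submission where

open import Defs
open import Data.Bool as Bool using (Bool; true; false; T; _∧_; _∨_; _xor_; not)
open import Data.Bool.Properties using (∧-assoc; ∧-identityʳ; ∧-zeroʳ; ∨-comm; ∨-identityʳ)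
open import Data.Empty using (⊥; ⊥-elim)
open import Data.Fin as Fin using
  (Fin; zero; suc; toℕ; #_; fromℕ<; punchOut; _↑ˡ_; _↑ʳ_; splitAt; join; combine)
open import Data.Fin.Permutation using (Permutation′; permutation)
import Data.Fin.Properties as Finₚ
open import Data.Fin.Subset using (Subset; ∣_∣; _⊆_)
open import Data.Fin.Subset.Properties using (x∈p∩q⁺; x∈p∩q⁻)
import Data.Integer as ℤ
import Data.Integer.Properties as ℤₚ
open import Data.Nat as ℕ using
  (ℕ; zero; suc; _+_; _*_; _^_; _⊓_; _≤_; _<_; _≤ᵇ_; _<ᵇ_; _≤?_; _<?_; z≤n; s≤s; NonZero; >-nonZero)
open import Data.Nat.Coprimality using (Coprime; 1-coprimeTo)
open import Data.Nat.DivMod using (_/_; _%_; m≡m%n+[m/n]*n; m%n≤n; m≥n⇒m/n>0)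
open import Data.Nat.Properties
open import Algebra.Properties.Semiring.Sum +-*-semiring
open import Data.Nat.Tactic.RingSolver using (solve-∀)
open import Data.Product using (Σ; ∃-syntax; ∃₂; _×_; _,_; proj₁; proj₂)
open import Data.Rational as ℚ using (ℚ; 0ℚ; mkℚ; toℚᵘ)
import Data.Rational.Properties as ℚₚ
open import Data.Rational.Unnormalised as ℚᵘ using (mkℚᵘ; *≡*; *≤*)
import Data.Rational.Unnormalised.Properties as ℚᵘₚ
open import Data.Sum using (_⊎_; inj₁; inj₂; map₂)
open import Data.Sum.Properties using (inj₁-injective; inj₂-injective)
open import Data.Vec using ([]; _∷_; lookup; tabulate)
open import Data.Vec.Properties using ([]=⇒lookup; lookup⇒[]=; lookup∘tabulate)
open import Function using (_∘_; _$_)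
open import Function.Bundles using (_⇔_; mk⇔; mk↣; module Injection)
open import Function.Definitions using (Injective)
open import Relation.Binary using (tri<; tri≈; tri>)
open import Relation.Binary.PropositionalEquality
open import Relation.Nullary using (¬_; Dec; does; yes; no; contradiction)
open import Relation.Nullary.Decidable using (dec-true; dec-false; toWitness; _×-dec_)

private
  variable
    m n : ℕ
    A V W P Q : Set

-- Finite sums

sum-const : ∀ n c → sum {n} (λ _ → c) ≡ n * c
sum-const zero    c = refl
sum-const (suc n) c = cong (c +_) (sum-const n c)

sum-mono-≤ : {f g : Fin n → ℕ} → (∀ i → f i ≤ g i) → sum f ≤ sum g
sum-mono-≤ {zero}  f≤g = z≤n
sum-mono-≤ {suc n} f≤g = +-mono-≤ (f≤g zero) (sum-mono-≤ (f≤g ∘ suc))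

sum-mono-< : {f g : Fin n → ℕ} → (∀ i → f i ≤ g i) → ∀ i → f i < g i → sum f < sum g
sum-mono-< f≤g zero    fi<gi = +-mono-<-≤ fi<gi (sum-mono-≤ (f≤g ∘ suc))
sum-mono-< f≤g (suc i) fi<gi = +-mono-≤-< (f≤g zero) (sum-mono-< (f≤g ∘ suc) i fi<gi)

term≤sum : (f : Fin n → ℕ) → ∀ i → f i ≤ sum f
term≤sum f zero    = m≤m+n _ _
term≤sum f (suc i) = ≤-trans (term≤sum (f ∘ suc) i) (m≤n+m _ _)

sum≤n*c : {f : Fin n → ℕ} → ∀ c → (∀ i → f i ≤ c) → sum f ≤ n * c
sum≤n*c {n} c f≤c = ≤-trans (sum-mono-≤ f≤c) (≤-reflexive (sum-const n c))

n*c≤sum : {f : Fin n → ℕ} → ∀ c → (∀ i → c ≤ f i) → n * c ≤ sum f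
n*c≤sum {n} c c≤f = ≤-trans (≤-reflexive (sym (sum-const n c))) (sum-mono-≤ c≤f)

∑³ : (Fin n → Fin n → Fin n → ℕ) → ℕ
∑³ f = sum λ x → sum λ y → sum λ z → f x y z

∑³-cong : {f g : Fin n → Fin n → Fin n → ℕ} → (∀ x y z → f x y z ≡ g x y z) → ∑³ f ≡ ∑³ g
∑³-cong f≗g = sum-cong-≗ λ x → sum-cong-≗ λ y → sum-cong-≗ λ z → f≗g x y z

∑³-+ : (f g : Fin n → Fin n → Fin n → ℕ) →
       ∑³ (λ x y z → f x y z + g x y z) ≡ ∑³ f + ∑³ g
∑³-+ f g = begin
  ∑³ (λ x y z → f x y z + g x y z)
    ≡⟨ sum-cong-≗ (λ x → sum-cong-≗ λ y → ∑-distrib-+ (f x y) (g x y)) ⟩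
  sum (λ x → sum λ y → sum (f x y) + sum (g x y))
    ≡⟨ sum-cong-≗ (λ x → ∑-distrib-+ (λ y → sum (f x y)) (λ y → sum (g x y))) ⟩
  sum (λ x → sum (λ y → sum (f x y)) + sum (λ y → sum (g x y)))
    ≡⟨ ∑-distrib-+ (λ x → sum λ y → sum (f x y)) (λ x → sum λ y → sum (g x y)) ⟩
  ∑³ f + ∑³ g ∎
  where open ≡-Reasoning

∑³-swap₁₂ : (f : Fin n → Fin n → Fin n → ℕ) → ∑³ f ≡ ∑³ (λ x y z → f y x z)
∑³-swap₁₂ f = ∑-comm (λ x y → sum (f x y))

∑³-swap₂₃ : (f : Fin n → Fin n → Fin n → ℕ) → ∑³ f ≡ ∑³ (λ x y z → f x z y)
∑³-swap₂₃ f = sum-cong-≗ λ x → ∑-comm (f x)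

∑³-* : (f g h : Fin n → ℕ) → ∑³ (λ x y z → f x * g y * h z) ≡ sum f * sum g * sum h
∑³-* f g h = begin
  ∑³ (λ x y z → f x * g y * h z)
    ≡⟨ sum-cong-≗ (λ x → sum-cong-≗ λ y → sym (*-distribˡ-sum (f x * g y) h)) ⟩
  sum (λ x → sum λ y → f x * g y * sum h)
    ≡⟨ sum-cong-≗ (λ x → sym (*-distribʳ-sum (sum h) (λ y → f x * g y))) ⟩
  sum (λ x → sum (λ y → f x * g y) * sum h)
    ≡⟨ sum-cong-≗ (λ x → cong (_* sum h) (sym (*-distribˡ-sum (f x) g))) ⟩
  sum (λ x → f x * sum g * sum h)
    ≡⟨ sym (*-distribʳ-sum (sum h) (λ x → f x * sum g)) ⟩
  sum (λ x → f x * sum g) * sum h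
    ≡⟨ cong (_* sum h) (sym (*-distribʳ-sum (sum g) f)) ⟩
  sum f * sum g * sum h ∎
  where open ≡-Reasoning

𝟙-∧ : ∀ p q → 𝟙 (p ∧ q) ≡ 𝟙 p * 𝟙 q
𝟙-∧ true  q = sym (*-identityˡ (𝟙 q))
𝟙-∧ false q = refl

𝟙≤1 : ∀ p → 𝟙 p ≤ 1
𝟙≤1 true  = ≤-refl
𝟙≤1 false = z≤n

∣∣≡sum : (U : Subset n) → ∣ U ∣ ≡ sum (λ x → 𝟙 (lookup U x))
∣∣≡sum []          = refl
∣∣≡sum (true  ∷ U) = cong suc (∣∣≡sum U)
∣∣≡sum (false ∷ U) = ∣∣≡sum U

-- Rational bounds as inequalities between naturals

ℕ→ℚ-≃ : ∀ k → toℚᵘ (ℕ→ℚ k) ℚᵘ.≃ mkℚᵘ (ℤ.+ k) 0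
ℕ→ℚ-≃ k = ℚₚ.toℚᵘ-fromℚᵘ (mkℚᵘ (ℤ.+ k) 0)

ℕ→ℚ-* : ∀ m n → ℕ→ℚ (m * n) ≡ ℕ→ℚ m ℚ.* ℕ→ℚ n
ℕ→ℚ-* m n = ℚₚ.toℚᵘ-injective (begin
  toℚᵘ (ℕ→ℚ (m * n))                  ≈⟨ ℕ→ℚ-≃ (m * n) ⟩
  mkℚᵘ (ℤ.+ (m * n)) 0                ≡⟨ cong (λ i → mkℚᵘ i 0) (ℤₚ.pos-* m n) ⟩
  mkℚᵘ (ℤ.+ m) 0 ℚᵘ.* mkℚᵘ (ℤ.+ n) 0  ≈⟨ ℚᵘₚ.*-cong (ℕ→ℚ-≃ m) (ℕ→ℚ-≃ n) ⟨
  toℚᵘ (ℕ→ℚ m) ℚᵘ.* toℚᵘ (ℕ→ℚ n)      ≈⟨ ℚₚ.toℚᵘ-homo-* (ℕ→ℚ m) (ℕ→ℚ n) ⟨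
  toℚᵘ (ℕ→ℚ m ℚ.* ℕ→ℚ n)              ∎)
  where open ℚᵘₚ.≃-Reasoning

-- Products in `ℚ` are normalised, which hides their numerator and denominator. In `ℚᵘ` the fraction
-- stays literal, so the two comparisons below become cross-multiplications in `ℕ`.
scaled-≃ : ∀ a d .(c : Coprime a (suc d)) k →
  toℚᵘ (mkℚ (ℤ.+ a) d c ℚ.* ℕ→ℚ k) ℚᵘ.≃ mkℚᵘ (ℤ.+ (a * k)) d
scaled-≃ a d c k = begin
  toℚᵘ (mkℚ (ℤ.+ a) d c ℚ.* ℕ→ℚ k)        ≈⟨ ℚₚ.toℚᵘ-homo-* (mkℚ (ℤ.+ a) d c) (ℕ→ℚ k) ⟩
  mkℚᵘ (ℤ.+ a) d ℚᵘ.* toℚᵘ (ℕ→ℚ k)        ≈⟨ ℚᵘₚ.*-cong (ℚᵘₚ.≃-refl {mkℚᵘ (ℤ.+ a) d}) (ℕ→ℚ-≃ k) ⟩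
  mkℚᵘ (ℤ.+ a) d ℚᵘ.* mkℚᵘ (ℤ.+ k) 0      ≈⟨ *≡* (cong₂ ℤ._*_ (sym (ℤₚ.pos-* a k)) (cong (λ e → ℤ.+ suc e) (sym (*-identityʳ d)))) ⟩
  mkℚᵘ (ℤ.+ (a * k)) d                    ∎
  where open ℚᵘₚ.≃-Reasoning

scaled-≤⁺ : ∀ a d .(c : Coprime a (suc d)) m k → m * suc d ≤ a * k → ℕ→ℚ m ℚ.≤ mkℚ (ℤ.+ a) d c ℚ.* ℕ→ℚ k
scaled-≤⁺ a d c m k md≤ak = ℚₚ.toℚᵘ-cancel-≤ (begin
  toℚᵘ (ℕ→ℚ m)                            ≃⟨ ℕ→ℚ-≃ m ⟩
  mkℚᵘ (ℤ.+ m) 0                          ≤⟨ *≤* le ⟩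
  mkℚᵘ (ℤ.+ (a * k)) d                    ≃⟨ scaled-≃ a d c k ⟨
  toℚᵘ (mkℚ (ℤ.+ a) d c ℚ.* ℕ→ℚ k)        ∎)
  where
  open ℚᵘₚ.≤-Reasoning
  le : ℤ.+ m ℤ.* ℤ.+ suc d ℤ.≤ ℤ.+ (a * k) ℤ.* ℤ.+ 1
  le rewrite sym (ℤₚ.pos-* m (suc d)) | ℤₚ.*-identityʳ (ℤ.+ (a * k)) = ℤ.+≤+ md≤ak

scaled-≤⁻ : ∀ a d .(c : Coprime a (suc d)) m k → ℕ→ℚ m ℚ.≤ mkℚ (ℤ.+ a) d c ℚ.* ℕ→ℚ k → m * suc d ≤ a * k
scaled-≤⁻ a d c m k le = un (begin
  mkℚᵘ (ℤ.+ m) 0                          ≃⟨ ℕ→ℚ-≃ m ⟨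
  toℚᵘ (ℕ→ℚ m)                            ≤⟨ ℚₚ.toℚᵘ-mono-≤ le ⟩
  toℚᵘ (mkℚ (ℤ.+ a) d c ℚ.* ℕ→ℚ k)        ≃⟨ scaled-≃ a d c k ⟩
  mkℚᵘ (ℤ.+ (a * k)) d                    ∎)
  where
  open ℚᵘₚ.≤-Reasoning
  un : mkℚᵘ (ℤ.+ m) 0 ℚᵘ.≤ mkℚᵘ (ℤ.+ (a * k)) d → m * suc d ≤ a * k
  un (*≤* le) rewrite sym (ℤₚ.pos-* m (suc d)) | ℤₚ.*-identityʳ (ℤ.+ (a * k)) = ℤₚ.drop‿+≤+ le

≠ᵇ-true : {x y : Fin n} → x ≢ y → x ≠ᵇ y ≡ true
≠ᵇ-true {x = x} {y} x≢y rewrite dec-false (x Finₚ.≟ y) x≢y = refl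

-- The number of edges of K₃ U V W

six : (A → A → A → ℕ) → A → A → A → ℕ
six f x y z = f x y z + (f x z y + (f y x z + (f y z x + (f z x y + f z y x))))

-- A sum over all ordered triples does not change when its variables are permuted, so each
-- permutation applied to `f` can be moved onto `o` as its inverse.
∑³-six : (o f : Fin n → Fin n → Fin n → ℕ) →
         ∑³ (λ x y z → o x y z * six f x y z) ≡ ∑³ (λ x y z → six o x y z * f x y z)
∑³-six o f = begin
  ∑³ (λ x y z → o x y z * six f x y z)
    ≡⟨ ∑³-cong (λ x y z → distribˡ (o x y z) (f x y z) (f x z y) (f y x z) (f y z x) (f z x y) (f z y x)) ⟩
  ∑³ (λ x y z → o x y z * f x y z + (o x y z * f x z y + (o x y z * f y x z +
        (o x y z * f y z x + (o x y z * f z x y + o x y z * f z y x)))))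
    ≡⟨ split (λ x y z → o x y z * f x y z) (λ x y z → o x y z * f x z y) (λ x y z → o x y z * f y x z)
             (λ x y z → o x y z * f y z x) (λ x y z → o x y z * f z x y) (λ x y z → o x y z * f z y x) ⟩
  ∑³ (λ x y z → o x y z * f x y z) + (∑³ (λ x y z → o x y z * f x z y) + (∑³ (λ x y z → o x y z * f y x z) +
        (∑³ (λ x y z → o x y z * f y z x) + (∑³ (λ x y z → o x y z * f z x y) + ∑³ (λ x y z → o x y z * f z y x)))))
    ≡⟨ cong (∑³ (λ x y z → o x y z * f x y z) +_)
        (cong₂ _+_ (∑³-swap₂₃ (λ x y z → o x y z * f x z y))
        (cong₂ _+_ (∑³-swap₁₂ (λ x y z → o x y z * f y x z))
        -- The two 3-cycles are inverse to each other, so their terms arrive in swapped order; the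
        -- transpositions keep their places.
        (trans (cong₂ _+_ yzx (cong₂ _+_ zxy zyx))
               (exchange (∑³ (λ x y z → o z x y * f x y z)) (∑³ (λ x y z → o y z x * f x y z)) _)))) ⟩
  ∑³ (λ x y z → o x y z * f x y z) + (∑³ (λ x y z → o x z y * f x y z) + (∑³ (λ x y z → o y x z * f x y z) +
        (∑³ (λ x y z → o y z x * f x y z) + (∑³ (λ x y z → o z x y * f x y z) + ∑³ (λ x y z → o z y x * f x y z)))))
    ≡⟨ split (λ x y z → o x y z * f x y z) (λ x y z → o x z y * f x y z) (λ x y z → o y x z * f x y z)
             (λ x y z → o y z x * f x y z) (λ x y z → o z x y * f x y z) (λ x y z → o z y x * f x y z) ⟨
  ∑³ (λ x y z → o x y z * f x y z + (o x z y * f x y z + (o y x z * f x y z +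
        (o y z x * f x y z + (o z x y * f x y z + o z y x * f x y z)))))
    ≡⟨ ∑³-cong (λ x y z → distribʳ (f x y z) (o x y z) (o x z y) (o y x z) (o y z x) (o z x y) (o z y x)) ⟨
  ∑³ (λ x y z → six o x y z * f x y z) ∎
  where
  open ≡-Reasoning
  yzx : ∑³ (λ x y z → o x y z * f y z x) ≡ ∑³ (λ x y z → o z x y * f x y z)
  yzx = trans (∑³-swap₁₂ (λ x y z → o x y z * f y z x)) (∑³-swap₂₃ (λ x y z → o y x z * f x z y))
  zxy : ∑³ (λ x y z → o x y z * f z x y) ≡ ∑³ (λ x y z → o y z x * f x y z)
  zxy = trans (∑³-swap₂₃ (λ x y z → o x y z * f z x y)) (∑³-swap₁₂ (λ x y z → o x z y * f y x z))
  zyx : ∑³ (λ x y z → o x y z * f z y x) ≡ ∑³ (λ x y z → o z y x * f x y z)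
  zyx = trans (∑³-swap₁₂ (λ x y z → o x y z * f z y x))
       (trans (∑³-swap₂₃ (λ x y z → o y x z * f z x y)) (∑³-swap₁₂ (λ x y z → o z x y * f y x z)))
  exchange : ∀ p q r → p + (q + r) ≡ q + (p + r)
  exchange p q r = trans (sym (+-assoc p q r)) (trans (cong (_+ r) (+-comm p q)) (+-assoc q p r))
  distribˡ : ∀ c p q r s t u → c * (p + (q + (r + (s + (t + u))))) ≡
                              c * p + (c * q + (c * r + (c * s + (c * t + c * u))))
  distribˡ = solve-∀
  distribʳ : ∀ c p q r s t u → (p + (q + (r + (s + (t + u))))) * c ≡
                              p * c + (q * c + (r * c + (s * c + (t * c + u * c))))
  distribʳ = solve-∀
  split : (p q r s t u : Fin _ → Fin _ → Fin _ → ℕ) →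
          ∑³ (λ x y z → p x y z + (q x y z + (r x y z + (s x y z + (t x y z + u x y z)))))
          ≡ ∑³ p + (∑³ q + (∑³ r + (∑³ s + (∑³ t + ∑³ u))))
  split p q r s t u =
    trans (∑³-+ p _) (cong (∑³ p +_) (
    trans (∑³-+ q _) (cong (∑³ q +_) (
    trans (∑³-+ r _) (cong (∑³ r +_) (
    trans (∑³-+ s _) (cong (∑³ s +_) (∑³-+ t u))))))))

increasing : Fin n → Fin n → Fin n → ℕ
increasing x y z = 𝟙 (does (x Fin.<? y) ∧ does (y Fin.<? z))

-- Three distinct vertices have a single sorted order. Of the eight outcomes of the three
-- comparisons, six are orders and the two cyclic ones contradict transitivity.
six-increasing : {x y z : Fin n} → x ≢ y → y ≢ z → x ≢ z → six increasing x y z ≡ 1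
six-increasing {x = x} {y} {z} x≢y y≢z x≢z with Finₚ.<-cmp x y | Finₚ.<-cmp y z | Finₚ.<-cmp x z
... | tri≈ _ x≡y _ | _ | _ = contradiction x≡y x≢y
... | _ | tri≈ _ y≡z _ | _ = contradiction y≡z y≢z
... | _ | _ | tri≈ _ x≡z _ = contradiction x≡z x≢z
... | tri< x<y _ y≮x | tri< y<z _ z≮y | tri< x<z _ z≮x
  rewrite dec-true (x Fin.<? y) x<y | dec-false (y Fin.<? x) y≮x
        | dec-true (y Fin.<? z) y<z | dec-false (z Fin.<? y) z≮y
        | dec-true (x Fin.<? z) x<z | dec-false (z Fin.<? x) z≮x = refl
... | tri< x<y _ y≮x | tri> y≮z _ z<y | tri< x<z _ z≮x
  rewrite dec-true (x Fin.<? y) x<y | dec-false (y Fin.<? x) y≮x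
        | dec-true (z Fin.<? y) z<y | dec-false (y Fin.<? z) y≮z
        | dec-true (x Fin.<? z) x<z | dec-false (z Fin.<? x) z≮x = refl
... | tri< x<y _ y≮x | tri> y≮z _ z<y | tri> x≮z _ z<x
  rewrite dec-true (x Fin.<? y) x<y | dec-false (y Fin.<? x) y≮x
        | dec-true (z Fin.<? y) z<y | dec-false (y Fin.<? z) y≮z
        | dec-true (z Fin.<? x) z<x | dec-false (x Fin.<? z) x≮z = refl
... | tri> x≮y _ y<x | tri< y<z _ z≮y | tri< x<z _ z≮x
  rewrite dec-true (y Fin.<? x) y<x | dec-false (x Fin.<? y) x≮y
        | dec-true (y Fin.<? z) y<z | dec-false (z Fin.<? y) z≮y
        | dec-true (x Fin.<? z) x<z | dec-false (z Fin.<? x) z≮x = refl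
... | tri> x≮y _ y<x | tri< y<z _ z≮y | tri> x≮z _ z<x
  rewrite dec-true (y Fin.<? x) y<x | dec-false (x Fin.<? y) x≮y
        | dec-true (y Fin.<? z) y<z | dec-false (z Fin.<? y) z≮y
        | dec-true (z Fin.<? x) z<x | dec-false (x Fin.<? z) x≮z = refl
... | tri> x≮y _ y<x | tri> y≮z _ z<y | tri> x≮z _ z<x
  rewrite dec-true (y Fin.<? x) y<x | dec-false (x Fin.<? y) x≮y
        | dec-true (z Fin.<? y) z<y | dec-false (y Fin.<? z) y≮z
        | dec-true (z Fin.<? x) z<x | dec-false (x Fin.<? z) x≮z = refl
... | tri< x<y _ _ | tri< y<z _ _ | tri> x≮z _ _ = contradiction (Finₚ.<-trans x<y y<z) x≮z
... | tri> _ _ y<x | tri> _ _ z<y | tri< _ _ z≮x = contradiction (Finₚ.<-trans z<y y<x) z≮x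

Disjoint : Subset n → Subset n → Set
Disjoint U V = ∀ x → lookup U x ≡ true → lookup V x ≡ true → ⊥

member³ : Subset n → Subset n → Subset n → Fin n → Fin n → Fin n → Bool
member³ U V W x y z = lookup U x ∧ lookup V y ∧ lookup W z

-- A vertex lies in at most one of three disjoint sets U, V, W, so it has one of four colours;
-- that the six disjuncts in the edge relation of K₃ U V W exclude each other is then a finite check.
rainbow : Fin 4 → Fin 4 → Fin 4 → Bool
rainbow i j k = does (i Finₚ.≟ # 0) ∧ does (j Finₚ.≟ # 1) ∧ does (k Finₚ.≟ # 2)

rainbow-exclusive : ∀ i j k →
    𝟙 (rainbow i j k ∨ rainbow i k j ∨ rainbow j i k ∨ rainbow j k i ∨ rainbow k i j ∨ rainbow k j i)
    ≡ six (λ i j k → 𝟙 (rainbow i j k)) i j k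
rainbow-exclusive = toWitness {a? = Finₚ.all? λ i → Finₚ.all? λ j → Finₚ.all? λ k → _ ≟ _} _

module _ {U V W : Subset n} (UV : Disjoint U V) (VW : Disjoint V W) (UW : Disjoint U W) where

  private
    distinct : ∀ {X Y : Subset n} {x y} → Disjoint X Y →
               lookup X x ≡ true → lookup Y y ≡ true → x ≢ y
    distinct XY x∈X y∈Y refl = XY _ x∈X y∈Y

  inK₃≡member³ : ∀ x y z → inK₃ U V W x y z ≡ member³ U V W x y z
  inK₃≡member³ x y z with lookup U x in x∈U | lookup V y in y∈V | lookup W z in z∈W
  ... | false | _     | _     = ∧-zeroʳ _
  ... | true  | false | _     = ∧-zeroʳ _
  ... | true  | true  | false = ∧-zeroʳ _
  ... | true  | true  | true
    rewrite ≠ᵇ-true (distinct {U} {V} UV x∈U y∈V) | ≠ᵇ-true (distinct {V} {W} VW y∈V z∈W)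
          | ≠ᵇ-true (distinct {U} {W} UW x∈U z∈W) = refl

  private
    colour : ∀ x → ∃[ i ] lookup U x ≡ does (i Finₚ.≟ # 0) ×
                          lookup V x ≡ does (i Finₚ.≟ # 1) ×
                          lookup W x ≡ does (i Finₚ.≟ # 2)
    colour x with lookup U x in x∈U | lookup V x in x∈V | lookup W x in x∈W
    ... | true  | true  | _     = ⊥-elim (UV x x∈U x∈V)
    ... | true  | false | true  = ⊥-elim (UW x x∈U x∈W)
    ... | true  | false | false = # 0 , refl , refl , refl
    ... | false | true  | true  = ⊥-elim (VW x x∈V x∈W)
    ... | false | true  | false = # 1 , refl , refl , refl
    ... | false | false | true  = # 2 , refl , refl , refl
    ... | false | false | false = Fin.fromℕ 3 , refl , refl , refl

  edge-K₃ : ∀ x y z → 𝟙 (edge (K₃ U V W) x y z) ≡ six (λ x y z → 𝟙 (member³ U V W x y z)) x y z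
  edge-K₃ x y z
    rewrite inK₃≡member³ x y z | inK₃≡member³ x z y | inK₃≡member³ y x z
          | inK₃≡member³ y z x | inK₃≡member³ z x y | inK₃≡member³ z y x
    with colour x | colour y | colour z
  ... | i , Ux , Vx , Wx | j , Uy , Vy , Wy | k , Uz , Vz , Wz
    rewrite Ux | Vx | Wx | Uy | Vy | Wy | Uz | Vz | Wz = rainbow-exclusive i j k

  -- An edge is counted in its increasing order, but it may be in another order that it lies in
  -- `U × V × W`. `∑³-six` moves the six orders from membership onto `increasing`, where they add up
  -- to 1; what remains factors into three sums.
  ∥K₃∥ : ∥ K₃ U V W ∥ ≡ ∣ U ∣ * ∣ V ∣ * ∣ W ∣
  ∥K₃∥ = begin
    ∥ K₃ U V W ∥
      ≡⟨ ∑³-cong (λ x y z →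
           trans (cong 𝟙 (sym (∧-assoc (does (x Fin.<? y)) (does (y Fin.<? z)) (edge (K₃ U V W) x y z))))
          (trans (𝟙-∧ (does (x Fin.<? y) ∧ does (y Fin.<? z)) (edge (K₃ U V W) x y z))
                 (cong (increasing x y z *_) (edge-K₃ x y z)))) ⟩
    ∑³ (λ x y z → increasing x y z * six (λ x y z → 𝟙 (member³ U V W x y z)) x y z)
      ≡⟨ ∑³-six increasing (λ x y z → 𝟙 (member³ U V W x y z)) ⟩
    ∑³ (λ x y z → six increasing x y z * 𝟙 (member³ U V W x y z))
      ≡⟨ ∑³-cong one ⟩
    ∑³ (λ x y z → 𝟙 (lookup U x) * 𝟙 (lookup V y) * 𝟙 (lookup W z))
      ≡⟨ ∑³-* (λ x → 𝟙 (lookup U x)) (λ y → 𝟙 (lookup V y)) (λ z → 𝟙 (lookup W z)) ⟩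
    sum (λ x → 𝟙 (lookup U x)) * sum (λ y → 𝟙 (lookup V y)) * sum (λ z → 𝟙 (lookup W z))
      ≡⟨ cong₂ _*_ (cong₂ _*_ (∣∣≡sum U) (∣∣≡sum V)) (∣∣≡sum W) ⟨
    ∣ U ∣ * ∣ V ∣ * ∣ W ∣ ∎
    where
    open ≡-Reasoning
    one : ∀ x y z → six increasing x y z * 𝟙 (member³ U V W x y z)
                    ≡ 𝟙 (lookup U x) * 𝟙 (lookup V y) * 𝟙 (lookup W z)
    one x y z with lookup U x in x∈U | lookup V y in y∈V | lookup W z in z∈W
    ... | false | _     | _     = *-zeroʳ (six increasing x y z)
    ... | true  | false | _     = *-zeroʳ (six increasing x y z)
    ... | true  | true  | false = *-zeroʳ (six increasing x y z)
    ... | true  | true  | true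
      rewrite six-increasing (distinct {U} {V} UV x∈U y∈V) (distinct {V} {W} VW y∈V z∈W)
                             (distinct {U} {W} UW x∈U z∈W) = refl

-- Homogeneous triples of sets

∨-elim : ∀ {C : Set} p {q} → (p ≡ true → C) → (q ≡ true → C) → p ∨ q ≡ true → C
∨-elim true  f g _ = f refl
∨-elim false f g q = g q

∨-introˡ : ∀ {p q} → p ≡ true → p ∨ q ≡ true
∨-introˡ refl = refl

∧-true : ∀ p {q} → p ∧ q ≡ true → p ≡ true × q ≡ true
∧-true true q = refl , q

sum-zero : {f : Fin n → ℕ} → (∀ i → f i ≡ 0) → sum f ≡ 0
sum-zero {n} f≗0 = trans (sum-cong-≗ f≗0) (sum-replicate-zero n)

∥∥-∧ : ∀ e {G K : ThreeGraph (Fin n)} →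
       (∀ x y z → edge G x y z ≡ e ∧ edge K x y z) → ∥ G ∥ ≡ 𝟙 e * ∥ K ∥
∥∥-∧ true  {G} {K} G≗K = trans
  (∑³-cong λ x y z → cong (λ b → 𝟙 (does (x Fin.<? y) ∧ does (y Fin.<? z) ∧ b)) (G≗K x y z))
  (sym (*-identityˡ ∥ K ∥))
∥∥-∧ false {G} {K} G≗∅ = sum-zero λ x → sum-zero λ y → sum-zero λ z → cong 𝟙 (zero³ x y z)
  where
  zero³ : ∀ x y z → does (x Fin.<? y) ∧ does (y Fin.<? z) ∧ edge G x y z ≡ false
  zero³ x y z rewrite G≗∅ x y z | ∧-zeroʳ (does (y Fin.<? z)) = ∧-zeroʳ _

-- The two transpositions generate all six orders, so an invariant property has to be checked only
-- in the order `U`, `V`, `W`.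
K₃-elim : ∀ (U V W : Subset n) (P : Fin n → Fin n → Fin n → Set) →
          (∀ {x y z} → P x y z → P y x z) → (∀ {x y z} → P x y z → P x z y) →
          (∀ {x y z} → lookup U x ≡ true → lookup V y ≡ true → lookup W z ≡ true → P x y z) →
          ∀ x y z → edge (K₃ U V W) x y z ≡ true → P x y z
K₃-elim U V W P P₁₂ P₂₃ base x y z =
  ∨-elim (inK₃ U V W x y z) (xyz x y z)                    $
  ∨-elim (inK₃ U V W x z y) (P₂₃ ∘ xyz x z y)              $
  ∨-elim (inK₃ U V W y x z) (P₁₂ ∘ xyz y x z)              $
  ∨-elim (inK₃ U V W y z x) (P₁₂ ∘ P₂₃ ∘ xyz y z x)        $
  ∨-elim (inK₃ U V W z x y) (P₂₃ ∘ P₁₂ ∘ xyz z x y)        $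
  P₁₂ ∘ P₂₃ ∘ P₁₂ ∘ xyz z y x
  where
  xyz : ∀ x y z → inK₃ U V W x y z ≡ true → P x y z
  xyz x y z e with ∧-true (x ≠ᵇ y ∧ y ≠ᵇ z ∧ x ≠ᵇ z) e
  ... | _ , e′ with ∧-true (lookup U x) e′
  ... | u , e″ with ∧-true (lookup V y) e″
  ... | v , w = base u v w

⊆-lookup : {U X : Subset n} → U ⊆ X → ∀ {x} → lookup U x ≡ true → lookup X x ≡ true
⊆-lookup {U = U} U⊆X {x} x∈U = []=⇒lookup (U⊆X (lookup⇒[]= x U x∈U))

0≤ε*ℕ : ∀ {ε} → 0ℚ ℚ.≤ ε → ∀ k → 0ℚ ℚ.≤ ε ℚ.* ℕ→ℚ k
0≤ε*ℕ {ε} 0≤ε k = ℚₚ.≤-trans (ℚₚ.≤-reflexive (sym (ℚₚ.*-zeroˡ (ℕ→ℚ k))))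
  (ℚₚ.*-monoʳ-≤-nonNeg (ℕ→ℚ k) {{ℚₚ.normalize-nonNeg k 1}} 0≤ε)

-- The density is 0 or 1 and is attained exactly on every choice of subsets, so the discrepancy is
-- 0.
homogeneous⇒Vdisc₃ : ∀ {ε} → 0ℚ ℚ.≤ ε → (H : ThreeGraph (Fin n)) (e : Bool) {X Y Z : Subset n} →
  Disjoint X Y → Disjoint Y Z → Disjoint X Z →
  (∀ {x y z} → lookup X x ≡ true → lookup Y y ≡ true → lookup Z z ≡ true → edge H x y z ≡ e) →
  Vdisc₃ ε X Y Z (H ∩ K₃ X Y Z)
homogeneous⇒Vdisc₃ {ε = ε} 0≤ε H e {X} {Y} {Z} XY YZ XZ const =
  ℕ→ℚ (𝟙 e) ,
  trans (cong ℕ→ℚ (trans (∥∥-∧ e {H ∩ K₃ X Y Z} {K₃ X Y Z} inside)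
                         (cong (𝟙 e *_) (∥K₃∥ {U = X} {Y} {Z} XY YZ XZ))))
        (ℕ→ℚ-* (𝟙 e) (∣ X ∣ * ∣ Y ∣ * ∣ Z ∣)) ,
  λ U V W U⊆X V⊆Y W⊆Z → begin
    ℚ.∣ ℕ→ℚ ∥ (H ∩ K₃ X Y Z) ∩ K₃ U V W ∥ ℚ.- ℕ→ℚ (𝟙 e) ℚ.* ℕ→ℚ (∣ U ∣ * ∣ V ∣ * ∣ W ∣) ∣
      ≡⟨ cong (λ q → ℚ.∣ q ℚ.- ℕ→ℚ (𝟙 e) ℚ.* ℕ→ℚ (∣ U ∣ * ∣ V ∣ * ∣ W ∣) ∣)
           (trans (cong ℕ→ℚ (count U V W U⊆X V⊆Y W⊆Z)) (ℕ→ℚ-* (𝟙 e) (∣ U ∣ * ∣ V ∣ * ∣ W ∣))) ⟩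
    ℚ.∣ ℕ→ℚ (𝟙 e) ℚ.* ℕ→ℚ (∣ U ∣ * ∣ V ∣ * ∣ W ∣) ℚ.- ℕ→ℚ (𝟙 e) ℚ.* ℕ→ℚ (∣ U ∣ * ∣ V ∣ * ∣ W ∣) ∣
      ≡⟨ cong ℚ.∣_∣ (ℚₚ.+-inverseʳ (ℕ→ℚ (𝟙 e) ℚ.* ℕ→ℚ (∣ U ∣ * ∣ V ∣ * ∣ W ∣))) ⟩
    0ℚ
      ≤⟨ 0≤ε*ℕ 0≤ε (∣ X ∣ * ∣ Y ∣ * ∣ Z ∣) ⟩
    ε ℚ.* ℕ→ℚ (∣ X ∣ * ∣ Y ∣ * ∣ Z ∣) ∎
  where
  open ℚₚ.≤-Reasoning
  constant : ∀ x y z → edge (K₃ X Y Z) x y z ≡ true → edge H x y z ≡ e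
  constant = K₃-elim X Y Z (λ x y z → edge H x y z ≡ e)
    (λ {x} {y} {z} → trans (edge-12 H y x z)) (λ {x} {y} {z} → trans (edge-23 H x z y)) const
  inside : ∀ x y z → edge H x y z ∧ edge (K₃ X Y Z) x y z ≡ e ∧ edge (K₃ X Y Z) x y z
  inside x y z with edge (K₃ X Y Z) x y z in xyz∈K
  ... | true  = cong (_∧ true) (constant x y z xyz∈K)
  ... | false = trans (∧-zeroʳ _) (sym (∧-zeroʳ e))
  module _ (U V W : Subset _) (U⊆X : U ⊆ X) (V⊆Y : V ⊆ Y) (W⊆Z : W ⊆ Z) where
    sub : ∀ x y z → edge (K₃ U V W) x y z ≡ true → edge (K₃ X Y Z) x y z ≡ true
    sub = K₃-elim U V W (λ x y z → edge (K₃ X Y Z) x y z ≡ true)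
      (λ {x} {y} {z} → trans (edge-12 (K₃ X Y Z) y x z))
      (λ {x} {y} {z} → trans (edge-23 (K₃ X Y Z) x z y))
      λ {x} {y} {z} x∈U y∈V z∈W → ∨-introˡ (trans (inK₃≡member³ {U = X} {Y} {Z} XY YZ XZ x y z)
        (cong₂ _∧_ (⊆-lookup U⊆X x∈U) (cong₂ _∧_ (⊆-lookup V⊆Y y∈V) (⊆-lookup W⊆Z z∈W))))
    restricted : ∀ x y z → (edge H x y z ∧ edge (K₃ X Y Z) x y z) ∧ edge (K₃ U V W) x y z
                           ≡ e ∧ edge (K₃ U V W) x y z
    restricted x y z with edge (K₃ U V W) x y z in xyz∈K
    ... | false = trans (∧-zeroʳ _) (sym (∧-zeroʳ e))
    ... | true rewrite inside x y z | sub x y z xyz∈K = cong (_∧ true) (∧-identityʳ e)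
    count : ∥ (H ∩ K₃ X Y Z) ∩ K₃ U V W ∥ ≡ 𝟙 e * (∣ U ∣ * ∣ V ∣ * ∣ W ∣)
    count = trans (∥∥-∧ e {(H ∩ K₃ X Y Z) ∩ K₃ U V W} {K₃ U V W} restricted)
      (cong (𝟙 e *_) (∥K₃∥ {U = U} {V} {W}
        (λ x x∈U x∈V → XY x (⊆-lookup U⊆X x∈U) (⊆-lookup V⊆Y x∈V))
        (λ x x∈V x∈W → YZ x (⊆-lookup V⊆Y x∈V) (⊆-lookup W⊆Z x∈W))
        (λ x x∈U x∈W → XZ x (⊆-lookup U⊆X x∈U) (⊆-lookup W⊆Z x∈W))))

-- Equipartitions into intervals of an order

-- Pigeonhole: if `r` were missed, punching it out would inject `Fin (suc n)` into `Fin n`.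
injective⇒surjective : {f : Fin n → Fin n} → Injective _≡_ _≡_ f → ∀ r → ∃[ v ] f v ≡ r
injective⇒surjective {suc n} {f} f-inj r with Finₚ.any? (λ v → f v Finₚ.≟ r)
... | yes found = found
... | no  ∄v    = contradiction (Finₚ.injective⇒≤ punched-inj) 1+n≰n
  where
  r≢f : ∀ v → r ≢ f v
  r≢f v r≡fv = ∄v (v , sym r≡fv)
  punched-inj : Injective _≡_ _≡_ (λ v → punchOut (r≢f v))
  punched-inj {u} {v} = f-inj ∘ Finₚ.punchOut-injective (r≢f u) (r≢f v)

injective⇒permutation : {f : Fin n → Fin n} → Injective _≡_ _≡_ f → Permutation′ n
injective⇒permutation {f = f} f-inj = permutation f (proj₁ ∘ f-surj) (proj₂ ∘ f-surj)
  (λ v → f-inj (proj₂ (f-surj (f v))))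
  where f-surj = injective⇒surjective f-inj

𝟙-does-mono : (P? : Dec P) (Q? : Dec Q) → (P → Q) → 𝟙 (does P?) ≤ 𝟙 (does Q?)
𝟙-does-mono (no _)  _  _   = z≤n
𝟙-does-mono (yes p) Q? P→Q rewrite dec-true Q? (P→Q p) = ≤-refl

dec-true⁻¹ : (P? : Dec P) → does P? ≡ true → P
dec-true⁻¹ (yes p) _ = p

∣tabulate∣ : (f : Fin n → Bool) → ∣ tabulate f ∣ ≡ sum (λ v → 𝟙 (f v))
∣tabulate∣ f = trans (∣∣≡sum (tabulate f)) (sum-cong-≗ λ v → cong 𝟙 (lookup∘tabulate f v))

sum-below : ∀ {n s} → s ≤ n → sum {n} (λ r → 𝟙 (does (toℕ r <? s))) ≡ s
sum-below {n}     {zero}  s≤n       = sum-zero {n} λ r → refl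
sum-below {suc n} {suc s} (s≤s s≤n) = cong suc (sum-below s≤n)

module _ {key : Fin n → ℕ} (key-inj : Injective _≡_ _≡_ key) where

  -- The position in sorted order. Keys may have gaps, whereas the parts need prescribed sizes;
  -- ranks take each of the values 0, ..., n - 1 once, so intervals are cut by rank.
  rank : Fin n → ℕ
  rank v = sum λ u → 𝟙 (does (key u <? key v))

  rank-mono-≤ : ∀ {u v} → key u ≤ key v → rank u ≤ rank v
  rank-mono-≤ {u} {v} u≤v = sum-mono-≤ λ w →
    𝟙-does-mono (key w <? key u) (key w <? key v) (λ w<u → <-≤-trans w<u u≤v)

  rank-mono-< : ∀ {u v} → key u < key v → rank u < rank v
  rank-mono-< {u} {v} u<v = sum-mono-<
    (λ w → 𝟙-does-mono (key w <? key u) (key w <? key v) (λ w<u → <-trans w<u u<v)) u strict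
    where
    strict : 𝟙 (does (key u <? key u)) < 𝟙 (does (key u <? key v))
    strict rewrite dec-false (key u <? key u) (<-irrefl refl) | dec-true (key u <? key v) u<v = ≤-refl

  rank-cancel-< : ∀ {u v} → rank u < rank v → key u < key v
  rank-cancel-< ru<rv = ≰⇒> λ v≤u → ≤⇒≯ (rank-mono-≤ v≤u) ru<rv

  rank<n : ∀ v → rank v < n
  rank<n v = <-≤-trans (sum-mono-< (λ u → 𝟙≤1 (does (key u <? key v))) v strict)
                       (≤-reflexive (trans (sum-const n 1) (*-identityʳ n)))
    where
    strict : 𝟙 (does (key v <? key v)) < 1
    strict rewrite dec-false (key v <? key v) (<-irrefl refl) = ≤-refl

  rank-injective : Injective _≡_ _≡_ rank
  rank-injective {u} {v} ru≡rv with <-cmp (key u) (key v)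
  ... | tri< u<v _ _ = contradiction ru≡rv (<⇒≢ (rank-mono-< u<v))
  ... | tri≈ _ u≡v _ = key-inj u≡v
  ... | tri> _ _ v<u = contradiction (sym ru≡rv) (<⇒≢ (rank-mono-< v<u))

  rankFin-injective : Injective _≡_ _≡_ (λ v → fromℕ< (rank<n v))
  rankFin-injective {u} {v} eq = rank-injective
    (trans (sym (Finₚ.toℕ-fromℕ< (rank<n u))) (trans (cong toℕ eq) (Finₚ.toℕ-fromℕ< (rank<n v))))

  rank-surjective : ∀ {r} → r < n → ∃[ v ] rank v ≡ r
  rank-surjective r<n with injective⇒surjective rankFin-injective (fromℕ< r<n)
  ... | v , eq = v , trans (sym (Finₚ.toℕ-fromℕ< (rank<n v))) (trans (cong toℕ eq) (Finₚ.toℕ-fromℕ< r<n))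

  sum-rank-below : ∀ {s} → s ≤ n → sum (λ v → 𝟙 (does (rank v <? s))) ≡ s
  sum-rank-below {s} s≤n = begin
    sum (λ v → 𝟙 (does (rank v <? s)))
      ≡⟨ sum-cong-≗ (λ v → cong (λ r → 𝟙 (does (r <? s))) (sym (Finₚ.toℕ-fromℕ< (rank<n v)))) ⟩
    sum (λ v → 𝟙 (does (toℕ (fromℕ< (rank<n v)) <? s)))
      ≡⟨ sum-permute (λ r → 𝟙 (does (toℕ r <? s))) (injective⇒permutation rankFin-injective) ⟨
    sum {n} (λ r → 𝟙 (does (toℕ r <? s)))
      ≡⟨ sum-below s≤n ⟩
    s ∎
    where open ≡-Reasoning

  slice : ℕ → ℕ → Subset n
  slice lo hi = tabulate λ v → does (lo ≤? rank v) ∧ does (rank v <? hi)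

  slice⁻ : ∀ lo hi v → lookup (slice lo hi) v ≡ true → lo ≤ rank v × rank v < hi
  slice⁻ lo hi v e
    with ∧-true (does (lo ≤? rank v)) (trans (sym (lookup∘tabulate _ v)) e)
  ... | lo≤r , r<hi = dec-true⁻¹ (lo ≤? rank v) lo≤r , dec-true⁻¹ (rank v <? hi) r<hi

  slice⁺ : ∀ {lo hi v} → lo ≤ rank v → rank v < hi → lookup (slice lo hi) v ≡ true
  slice⁺ {lo} {hi} {v} lo≤r r<hi
    rewrite lookup∘tabulate (λ v → does (lo ≤? rank v) ∧ does (rank v <? hi)) v
          | dec-true (lo ≤? rank v) lo≤r | dec-true (rank v <? hi) r<hi = refl

  -- The `hi` vertices of rank below `hi` split into the slice and the `lo` vertices of rank below
  -- `lo`. The additive form avoids truncated subtraction.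
  ∣slice∣ : ∀ {lo hi} → lo ≤ hi → hi ≤ n → ∣ slice lo hi ∣ + lo ≡ hi
  ∣slice∣ {lo} {hi} lo≤hi hi≤n = begin
    ∣ slice lo hi ∣ + lo
      ≡⟨ cong₂ _+_ (∣tabulate∣ (λ v → does (lo ≤? rank v) ∧ does (rank v <? hi)))
                   (sym (sum-rank-below (≤-trans lo≤hi hi≤n))) ⟩
    sum (λ v → 𝟙 (does (lo ≤? rank v) ∧ does (rank v <? hi))) + sum (λ v → 𝟙 (does (rank v <? lo)))
      ≡⟨ ∑-distrib-+ (λ v → 𝟙 (does (lo ≤? rank v) ∧ does (rank v <? hi))) (λ v → 𝟙 (does (rank v <? lo))) ⟨
    sum (λ v → 𝟙 (does (lo ≤? rank v) ∧ does (rank v <? hi)) + 𝟙 (does (rank v <? lo)))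
      ≡⟨ sum-cong-≗ (λ v → split (rank v)) ⟩
    sum (λ v → 𝟙 (does (rank v <? hi)))
      ≡⟨ sum-rank-below hi≤n ⟩
    hi ∎
    where
    open ≡-Reasoning
    split : ∀ r → 𝟙 (does (lo ≤? r) ∧ does (r <? hi)) + 𝟙 (does (r <? lo)) ≡ 𝟙 (does (r <? hi))
    split r with <-≤-connex r lo
    ... | inj₁ r<lo rewrite dec-true (r <? lo) r<lo | dec-false (lo ≤? r) (<⇒≱ r<lo)
                          | dec-true (r <? hi) (<-≤-trans r<lo lo≤hi) = refl
    ... | inj₂ lo≤r rewrite dec-true (lo ≤? r) lo≤r | dec-false (r <? lo) (≤⇒≯ lo≤r) = +-identityʳ _

interval-containing : (s : ℕ → ℕ) → ∀ {r} t → s 0 ≤ r → r < s t → ∃[ i ] i < t × s i ≤ r × r < s (suc i)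
interval-containing s zero    s₀≤r r<s₀ = contradiction r<s₀ (≤⇒≯ s₀≤r)
interval-containing s {r} (suc t) s₀≤r r<sₜ₊₁ with <-≤-connex r (s t)
... | inj₂ sₜ≤r = t , ≤-refl , sₜ≤r , r<sₜ₊₁
... | inj₁ r<sₜ with interval-containing s t s₀≤r r<sₜ
... | i , i<t , sᵢ≤r , r<sᵢ₊₁ = i , m<n⇒m<1+n i<t , sᵢ≤r , r<sᵢ₊₁

module _ (n t : ℕ) .{{_ : NonZero t}} where

  -- The first n % t intervals [boundary i, boundary (suc i)) are one longer than the others.
  boundary : ℕ → ℕ
  boundary i = i * (n / t) + i ⊓ (n % t)

  boundary-mono : ∀ {i j} → i ≤ j → boundary i ≤ boundary j
  boundary-mono i≤j = +-mono-≤ (*-monoˡ-≤ (n / t) i≤j) (⊓-monoˡ-≤ (n % t) i≤j)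

  boundary-last : boundary t ≡ n
  boundary-last = begin
    t * (n / t) + t ⊓ (n % t)  ≡⟨ cong₂ _+_ (*-comm t (n / t)) (m≥n⇒m⊓n≡n (m%n≤n n t)) ⟩
    n / t * t + n % t          ≡⟨ +-comm (n / t * t) (n % t) ⟩
    n % t + n / t * t          ≡⟨ m≡m%n+[m/n]*n n t ⟨
    n                          ∎
    where open ≡-Reasoning

  boundary-step-≥ : ∀ i → n / t + boundary i ≤ boundary (suc i)
  boundary-step-≥ i = ≤-trans (≤-reflexive (sym (+-assoc (n / t) (i * (n / t)) _)))
    (+-monoʳ-≤ (suc i * (n / t)) (⊓-monoˡ-≤ (n % t) (n≤1+n i)))

  boundary-step-≤ : ∀ i → boundary (suc i) ≤ suc (n / t) + boundary i
  boundary-step-≤ i = begin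
    (n / t + i * (n / t)) + suc i ⊓ (n % t)    ≤⟨ +-monoʳ-≤ (n / t + i * (n / t)) (⊓-suc i (n % t)) ⟩
    (n / t + i * (n / t)) + suc (i ⊓ (n % t))  ≡⟨ +-suc _ _ ⟩
    suc (n / t + i * (n / t) + i ⊓ (n % t))    ≡⟨ cong suc (+-assoc (n / t) _ _) ⟩
    suc (n / t) + boundary i                   ∎
    where
    open ≤-Reasoning
    ⊓-suc : ∀ i m → suc i ⊓ m ≤ suc (i ⊓ m)
    ⊓-suc i zero    = z≤n
    ⊓-suc i (suc m) = s≤s (⊓-monoʳ-≤ i (n≤1+n m))

sortedEquipartition : ∀ {t} {key : Fin n → ℕ} → Injective _≡_ _≡_ key → .{{_ : NonZero t}} → t ≤ n →
  Σ (Equipartition n t) λ P → ∀ {p q u v} → p Fin.< q →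
    lookup (part P p) u ≡ true → lookup (part P q) v ≡ true → key u < key v
sortedEquipartition {n} {t} {key} key-inj t≤n = partition , sorted
  where
  s = boundary n t
  s≤n : ∀ {i} → i ≤ t → s i ≤ n
  s≤n i≤t = ≤-trans (boundary-mono n t i≤t) (≤-reflexive (boundary-last n t))
  interval : Fin t → Subset n
  interval i = slice key-inj (s (toℕ i)) (s (suc (toℕ i)))
  sorted : ∀ {p q u v} → p Fin.< q → lookup (interval p) u ≡ true → lookup (interval q) v ≡ true → key u < key v
  sorted {p} {q} {u} {v} p<q u∈p v∈q = rank-cancel-< key-inj
    (<-≤-trans (proj₂ (slice⁻ key-inj (s (toℕ p)) (s (suc (toℕ p))) u u∈p))
    -- `p<q` unfolds to `suc p ≤ q`, so the right end of interval `p` is at most the left end of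
    -- interval `q`.
    (≤-trans (boundary-mono n t p<q)
             (proj₁ (slice⁻ key-inj (s (toℕ q)) (s (suc (toℕ q))) v v∈q))))
  size : ∀ i → ∣ interval i ∣ + s (toℕ i) ≡ s (suc (toℕ i))
  size i = ∣slice∣ key-inj (boundary-mono n t (n≤1+n (toℕ i))) (s≤n (Finₚ.toℕ<n i))
  size-≥ : ∀ i → n / t ≤ ∣ interval i ∣
  size-≥ i = +-cancelʳ-≤ (s (toℕ i)) _ _ (≤-trans (boundary-step-≥ n t (toℕ i)) (≤-reflexive (sym (size i))))
  size-≤ : ∀ i → ∣ interval i ∣ ≤ suc (n / t)
  size-≤ i = +-cancelʳ-≤ (s (toℕ i)) _ _ (≤-trans (≤-reflexive (size i)) (boundary-step-≤ n t (toℕ i)))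
  -- From `t ≤ n` the quotient `n / t` is at least 1, so no interval is empty.
  step : ∀ i → s i < s (suc i)
  step i = ≤-trans (+-monoˡ-≤ (s i) (m≥n⇒m/n>0 t≤n)) (boundary-step-≥ n t i)
  partition : Equipartition n t
  partition .part = interval
  partition .nonempty i with rank-surjective key-inj (<-≤-trans (step (toℕ i)) (s≤n (Finₚ.toℕ<n i)))
  ... | v , rv≡sᵢ = v , lookup⇒[]= v _ (slice⁺ key-inj (≤-reflexive (sym rv≡sᵢ))
                          (≤-<-trans (≤-reflexive rv≡sᵢ) (step (toℕ i))))
  partition .disjoint {i} {j} i≢j (v , v∈ij) with x∈p∩q⁻ (interval i) (interval j) v∈ij
  ... | v∈i , v∈j with Finₚ.<-cmp i j
  ... | tri< i<j _ _ = <-irrefl refl (sorted i<j ([]=⇒lookup v∈i) ([]=⇒lookup v∈j))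
  ... | tri≈ _ i≡j _ = i≢j i≡j
  ... | tri> _ _ j<i = <-irrefl refl (sorted j<i ([]=⇒lookup v∈j) ([]=⇒lookup v∈i))
  partition .cover v with interval-containing s t z≤n (<-≤-trans (rank<n key-inj v) (≤-reflexive (sym (boundary-last n t))))
  ... | i , i<t , sᵢ≤r , r<sᵢ₊₁ = fromℕ< i<t , lookup⇒[]= v _ (slice⁺ key-inj
        (subst (λ i → s i ≤ rank key-inj v) (sym (Finₚ.toℕ-fromℕ< i<t)) sᵢ≤r)
        (subst (λ i → rank key-inj v < s (suc i)) (sym (Finₚ.toℕ-fromℕ< i<t)) r<sᵢ₊₁))
  partition .balanced i j = ≤-trans (size-≤ i) (s≤s (size-≥ j))

-- Counting the pairs of a staircase

dec-false⁻¹ : (P? : Dec P) → does P? ≡ false → ¬ P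
dec-false⁻¹ (no ¬p) _ = ¬p

∨-false : ∀ p {q} → p ∨ q ≡ false → p ≡ false × q ≡ false
∨-false false q = refl , q

≡-from-⇔ : ∀ {p q} → (p ≡ true → q ≡ true) → (q ≡ true → p ≡ true) → p ≡ q
≡-from-⇔ {true}  {q}     f g = sym (f refl)
≡-from-⇔ {false} {true}  f g = g refl
≡-from-⇔ {false} {false} f g = refl

𝟙-∧-≤ʳ : ∀ p q → 𝟙 (p ∧ q) ≤ 𝟙 q
𝟙-∧-≤ʳ true  q = ≤-refl
𝟙-∧-≤ʳ false q = z≤n

𝟙-∨-≤ : ∀ p q → 𝟙 (p ∨ q) ≤ 𝟙 p + 𝟙 q
𝟙-∨-≤ true  q = m≤m+n 1 (𝟙 q)
𝟙-∨-≤ false q = ≤-refl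

sum-unique : {R : Fin n → Set} (R? : ∀ p → Dec (R p)) → (∀ {p q} → R p → R q → p ≡ q) →
             sum (λ p → 𝟙 (does (R? p))) ≤ 1
sum-unique {zero}  R? unique = z≤n
sum-unique {suc n} R? unique with R? zero
... | no _   = sum-unique (R? ∘ suc) (λ r s → Finₚ.suc-injective (unique r s))
... | yes r₀ = ≤-reflexive (cong suc (sum-zero λ p → cong 𝟙
                 (dec-false (R? (suc p)) λ r → Finₚ.0≢1+n (unique r₀ r))))

-- If row 0 meets R beyond column 0, then column 0 meets R at most in row 0 and can be removed;
-- otherwise row 0 can be.
sum-staircase : ∀ {m n} {R : Fin m → Fin n → Set} (R? : ∀ p q → Dec (R p q)) →
  (∀ {p q p′ q′} → R p q → R p′ q′ → p Fin.< p′ → q′ Fin.< q → ⊥) →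
  sum (λ p → sum λ q → 𝟙 (does (R? p q))) ≤ m + n
sum-staircase {zero}  {n}     R? stair = z≤n
sum-staircase {suc m} {zero}  R? stair = ≤-trans (≤-reflexive (sum-zero {suc m} λ p → refl)) z≤n
sum-staircase {suc m} {suc n} R? stair with Finₚ.any? (λ q → R? zero (suc q))
... | yes (q₀ , r₀) = begin
  sum (λ p → sum λ q → 𝟙 (does (R? p q)))
    ≡⟨ ∑-distrib-+ (λ p → 𝟙 (does (R? p zero))) (λ p → sum λ q → 𝟙 (does (R? p (suc q)))) ⟩
  sum (λ p → 𝟙 (does (R? p zero))) + sum (λ p → sum λ q → 𝟙 (does (R? p (suc q))))
    ≤⟨ +-mono-≤ (sum-unique (λ p → R? p zero) unique)
                (sum-staircase (λ p q → R? p (suc q)) (λ r r′ p<p′ q′<q → stair r r′ p<p′ (s≤s q′<q))) ⟩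
  1 + (suc m + n)
    ≡⟨ +-suc (suc m) n ⟨
  suc m + suc n ∎
  where
  open ≤-Reasoning
  unique : ∀ {p q} → _ → _ → p ≡ q
  unique {zero}  {zero}  _ _ = refl
  unique {suc p} {_}     r _ = ⊥-elim (stair r₀ r (s≤s z≤n) (s≤s z≤n))
  unique {zero}  {suc q} _ r = ⊥-elim (stair r₀ r (s≤s z≤n) (s≤s z≤n))
... | no ∄q = +-mono-≤
  (+-mono-≤ (𝟙≤1 (does (R? zero zero)))
            (≤-reflexive (sum-zero λ q → cong 𝟙 (dec-false (R? zero (suc q)) λ r → ∄q (q , r)))))
  (sum-staircase (R? ∘ suc) (λ r r′ p<p′ q′<q → stair r r′ (s≤s p<p′) q′<q))

-- Regular partitions of the induced sub-3-graphs of 𝒱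

index : 𝒱-Vertex → ℕ
index a[ i ] = i
index b[ j ] = j
index c[ k ] = k

-- These select two initial segments of the order a's, b's, c's, and together they determine the
-- class of a vertex. A part meets several classes only if one of the two tests is not constant on
-- it.
isA notC : 𝒱-Vertex → Bool
isA a[ _ ] = true
isA _      = false
notC c[ _ ] = false
notC _      = true

-- i ≤ j and i > j for a pair a_i, b_j; false for pairs of any other kind.
link gap : 𝒱-Vertex → 𝒱-Vertex → Bool
link a[ i ] b[ j ] = i ≤ᵇ j
link _      _      = false
gap a[ i ] b[ j ] = j <ᵇ i
gap _      _      = false

-- The indices matter only in the pair of the first two vertices; the third has merely to be a c.
-- This is why the exceptional set can consist of pairs of parts.
inc≡link : ∀ u v w → inc u v w ≡ link u v ∧ not (notC w)
inc≡link a[ i ] b[ j ] a[ _ ] = sym (∧-zeroʳ (i ≤ᵇ j))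
inc≡link a[ i ] b[ j ] b[ _ ] = sym (∧-zeroʳ (i ≤ᵇ j))
inc≡link a[ i ] b[ j ] c[ _ ] = sym (∧-identityʳ (i ≤ᵇ j))
inc≡link a[ _ ] a[ _ ] _ = refl
inc≡link a[ _ ] c[ _ ] _ = refl
inc≡link b[ _ ] _      _ = refl
inc≡link c[ _ ] _      _ = refl

link⁻ : ∀ u v → link u v ≡ true → ∃₂ λ i j → u ≡ a[ i ] × v ≡ b[ j ] × i ≤ j
link⁻ a[ i ] b[ j ] e = i , j , refl , refl , dec-true⁻¹ (i ≤? j) e

gap⁻ : ∀ u v → gap u v ≡ true → ∃₂ λ i j → u ≡ a[ i ] × v ≡ b[ j ] × j < i
gap⁻ a[ i ] b[ j ] e = i , j , refl , refl , dec-true⁻¹ (j <? i) e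

-- Equality of the classes makes `u′` an a and `v′` a b, and for such a pair the failure of `link`
-- is `gap`.
link-transfer : ∀ u u′ v v′ → isA u ≡ isA u′ → isA v ≡ isA v′ → notC v ≡ notC v′ →
  (link u v ≡ true → gap u′ v′ ≡ true → ⊥) → link u v ≡ true → link u′ v′ ≡ true
link-transfer a[ i ] a[ i′ ] b[ j ] b[ j′ ] _ _ _ ¬gap i≤j =
  dec-true (i′ ≤? j′) (≮⇒≥ λ j′<i′ → ¬gap i≤j (dec-true (j′ <? i′) j′<i′))

-- For M above all indices this sorts the vertices as a₀, a₁, …, b₀, b₁, …, c₀, c₁, ….
code : ℕ → 𝒱-Vertex → ℕ
code M a[ i ] = i
code M b[ j ] = M + j
code M c[ k ] = M + (M + k)

code-injective : ∀ {M} u v → index u < M → index v < M → code M u ≡ code M v → u ≡ v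
code-injective a[ i ] a[ j ] _ _ e = cong a[_] e
code-injective {M} a[ i ] b[ j ] i<M _ e = contradiction (subst (M ≤_) (sym e) (m≤m+n M j)) (<⇒≱ i<M)
code-injective {M} a[ i ] c[ j ] i<M _ e = contradiction (subst (M ≤_) (sym e) (m≤m+n M (M + j))) (<⇒≱ i<M)
code-injective {M} b[ i ] a[ j ] _ j<M e = contradiction (subst (M ≤_) e (m≤m+n M i)) (<⇒≱ j<M)
code-injective {M} b[ i ] b[ j ] _ _ e = cong b[_] (+-cancelˡ-≡ M i j e)
code-injective {M} b[ i ] c[ j ] i<M _ e =
  contradiction (subst (M ≤_) (sym (+-cancelˡ-≡ M i (M + j) e)) (m≤m+n M j)) (<⇒≱ i<M)
code-injective {M} c[ i ] a[ j ] _ j<M e = contradiction (subst (M ≤_) e (m≤m+n M (M + i))) (<⇒≱ j<M)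
code-injective {M} c[ i ] b[ j ] _ j<M e =
  contradiction (subst (M ≤_) (+-cancelˡ-≡ M (M + i) j e) (m≤m+n M i)) (<⇒≱ j<M)
code-injective {M} c[ i ] c[ j ] _ _ e = cong c[_] (+-cancelˡ-≡ M i j (+-cancelˡ-≡ M (M + i) (M + j) e))

isA-downward : ∀ {M} u v → index v < M → code M u < code M v → isA v ≡ true → isA u ≡ true
isA-downward a[ _ ] _      _   _   _ = refl
isA-downward {M} b[ i ] a[ j ] j<M u<v _ = contradiction (≤-<-trans (m≤m+n M i) u<v) (<-asym j<M)
isA-downward {M} c[ i ] a[ j ] j<M u<v _ = contradiction (≤-<-trans (m≤m+n M (M + i)) u<v) (<-asym j<M)

notC-downward : ∀ {M} u v → index v < M → code M u < code M v → notC v ≡ true → notC u ≡ true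
notC-downward a[ _ ] _      _   _   _ = refl
notC-downward b[ _ ] _      _   _   _ = refl
notC-downward {M} c[ i ] a[ j ] j<M u<v _ = contradiction (≤-<-trans (m≤m+n M (M + i)) u<v) (<-asym j<M)
notC-downward {M} c[ i ] b[ j ] j<M u<v _ =
  contradiction (≤-<-trans (m≤m+n M i) (+-cancelˡ-< M (M + i) j u<v)) (<-asym j<M)

part-disjoint : ∀ {t} (E : Equipartition n t) → ∀ {p q} → p ≢ q → Disjoint (part E p) (part E q)
part-disjoint E {p} {q} p≢q v v∈p v∈q =
  disjoint E p≢q (v , x∈p∩q⁺ (lookup⇒[]= v (part E p) v∈p , lookup⇒[]= v (part E q) v∈q))

module Parts {n t M} (f : Fin n → 𝒱-Vertex) (f<M : ∀ v → index (f v) < M) (E : Equipartition n t)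
  (sorted : ∀ {p q u v} → p Fin.< q → lookup (part E p) u ≡ true → lookup (part E q) v ≡ true →
            code M (f u) < code M (f v)) where

  _∈ₚ_ : Fin n → Fin t → Set
  v ∈ₚ p = lookup (part E p) v ≡ true

  _∈ₚ?_ : ∀ v p → Dec (v ∈ₚ p)
  v ∈ₚ? p = lookup (part E p) v Bool.≟ true

  Mixed : (𝒱-Vertex → Bool) → Fin t → Set
  Mixed φ p = ∃₂ λ u v → u ∈ₚ p × v ∈ₚ p × φ (f u) ≡ true × φ (f v) ≡ false

  mixed? : ∀ φ p → Dec (Mixed φ p)
  mixed? φ p = Finₚ.any? λ u → Finₚ.any? λ v →
    (u ∈ₚ? p) ×-dec (v ∈ₚ? p) ×-dec (φ (f u) Bool.≟ true) ×-dec (φ (f v) Bool.≟ false)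

  Crossing : Fin t → Fin t → Set
  Crossing p q = ∃₂ λ x x′ → ∃₂ λ y y′ → x ∈ₚ p × x′ ∈ₚ p × y ∈ₚ q × y′ ∈ₚ q ×
    link (f x) (f y) ≡ true × gap (f x′) (f y′) ≡ true

  crossing? : ∀ p q → Dec (Crossing p q)
  crossing? p q = Finₚ.any? λ x → Finₚ.any? λ x′ → Finₚ.any? λ y → Finₚ.any? λ y′ →
    (x ∈ₚ? p) ×-dec (x′ ∈ₚ? p) ×-dec (y ∈ₚ? q) ×-dec (y′ ∈ₚ? q) ×-dec
    (link (f x) (f y) Bool.≟ true) ×-dec (gap (f x′) (f y′) Bool.≟ true)

  Downward : (𝒱-Vertex → Bool) → Set
  Downward φ = ∀ u v → code M (f u) < code M (f v) → φ (f v) ≡ true → φ (f u) ≡ true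

  -- If `p` precedes `q`, the vertex of `p` that fails `φ` comes before the vertex of `q` that
  -- satisfies it, against downward closure.
  mixed-unique : ∀ {φ} → Downward φ → ∀ {p q} → Mixed φ p → Mixed φ q → p ≡ q
  mixed-unique {φ} down {p} {q} (u , v , u∈p , v∈p , φu , ¬φv) (u′ , v′ , u′∈q , v′∈q , φu′ , ¬φv′)
    with Finₚ.<-cmp p q
  ... | tri≈ _ p≡q _ = p≡q
  ... | tri< p<q _ _ = contradiction (trans (sym ¬φv) (down v u′ (sorted p<q v∈p u′∈q) φu′)) λ ()
  ... | tri> _ _ q<p = contradiction (trans (sym ¬φv′) (down v′ u (sorted q<p v′∈q u∈p) φu)) λ ()

  unmixed : ∀ {φ p} → ¬ Mixed φ p → ∀ {u v} → u ∈ₚ p → v ∈ₚ p → φ (f u) ≡ φ (f v)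
  unmixed {φ} ¬mixed {u} {v} u∈p v∈p with φ (f u) in φu | φ (f v) in φv
  ... | true  | true  = refl
  ... | false | false = refl
  ... | true  | false = contradiction (u , v , u∈p , v∈p , φu , φv) ¬mixed
  ... | false | true  = contradiction (v , u , v∈p , u∈p , φv , φu) ¬mixed

  -- Take the gap pair a_i, b_j of the first crossing, with j < i, and the linked pair a_i′, b_j′ of
  -- the second, with i′ ≤ j′. Sortedness gives i < i′ and j′ < j, hence the cycle j < i < i′ ≤ j′ <
  -- j.
  crossing-staircase : ∀ {p q p′ q′} → Crossing p q → Crossing p′ q′ → p Fin.< p′ → q′ Fin.< q → ⊥
  crossing-staircase (_ , x , _ , y , _ , x∈p , _ , y∈q , _ , x>y)
                     (u , _ , v , _ , u∈p′ , _ , v∈q′ , _ , u≤v , _) p<p′ q′<q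
    with gap⁻ (f x) (f y) x>y | link⁻ (f u) (f v) u≤v | sorted p<p′ x∈p u∈p′ | sorted q′<q v∈q′ y∈q
  ... | i , j , fx , fy , j<i | i′ , j′ , fu , fv , i′≤j′ | x<u | v<y
    rewrite fx | fy | fu | fv =
    <-asym (<-≤-trans x<u i′≤j′) (<-trans (+-cancelˡ-< M j′ j v<y) j<i)

  mixed : Fin t → Bool
  mixed p = does (mixed? isA p) ∨ does (mixed? notC p)

  crossing : Fin t → Fin t → Bool
  crossing p q = does (crossing? p q)

  -- In `crossing p q` the a's come from `p` and the b's from `q`, so both orientations are included
  -- to obtain a symmetric relation; the first conjunct makes it irreflexive.
  irregular : Fin t → Fin t → Bool
  irregular p q = (p ≠ᵇ q) ∧ ((mixed p ∨ mixed q) ∨ (crossing p q ∨ crossing q p))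

  Σ-pairs : PairSet (Fin t)
  Σ-pairs .pair = irregular
  Σ-pairs .pair-sym p q = cong₂ _∧_ (≠ᵇ-sym p q)
    (cong₂ _∨_ (∨-comm (mixed p) (mixed q)) (∨-comm (crossing p q) (crossing q p)))
    where
    ≠ᵇ-sym : ∀ p q → p ≠ᵇ q ≡ q ≠ᵇ p
    ≠ᵇ-sym p q with p Finₚ.≟ q | q Finₚ.≟ p
    ... | yes _   | yes _   = refl
    ... | no  _   | no  _   = refl
    ... | yes p≡q | no  q≢p = contradiction (sym p≡q) q≢p
    ... | no  p≢q | yes q≡p = contradiction (sym q≡p) p≢q
  Σ-pairs .pair-irrefl p rewrite ≠ᵇ-irrefl p = refl

  sum-mixed : sum (λ p → 𝟙 (mixed p)) ≤ 2
  sum-mixed = begin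
    sum (λ p → 𝟙 (mixed p))
      ≤⟨ sum-mono-≤ (λ p → 𝟙-∨-≤ (does (mixed? isA p)) (does (mixed? notC p))) ⟩
    sum (λ p → 𝟙 (does (mixed? isA p)) + 𝟙 (does (mixed? notC p)))
      ≡⟨ ∑-distrib-+ (λ p → 𝟙 (does (mixed? isA p))) (λ p → 𝟙 (does (mixed? notC p))) ⟩
    sum (λ p → 𝟙 (does (mixed? isA p))) + sum (λ p → 𝟙 (does (mixed? notC p)))
      ≤⟨ +-mono-≤ (sum-unique (mixed? isA) (mixed-unique {isA} λ u v → isA-downward (f u) (f v) (f<M v)))
                  (sum-unique (mixed? notC) (mixed-unique {notC} λ u v → notC-downward (f u) (f v) (f<M v))) ⟩
    2 ∎
    where open ≤-Reasoning

  -- All ordered pairs are counted. At most two mixed parts in either coordinate give 2t + 2t, and a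
  -- t × t staircase for either orientation of `crossing` gives another 2t + 2t.
  ∥Σ-pairs∥₂ : ∥ Σ-pairs ∥₂ ≤ t * 8
  ∥Σ-pairs∥₂ = begin
    ∥ Σ-pairs ∥₂
      ≤⟨ sum-mono-≤ (λ p → sum-mono-≤ λ q → bound p q) ⟩
    sum (λ p → sum λ q → (𝟙 (mixed p) + 𝟙 (mixed q)) + (𝟙 (crossing p q) + 𝟙 (crossing q p)))
      ≡⟨ sum-cong-≗ (λ p → ∑-distrib-+ (λ q → 𝟙 (mixed p) + 𝟙 (mixed q)) (λ q → 𝟙 (crossing p q) + 𝟙 (crossing q p))) ⟩
    sum (λ p → sum (λ q → 𝟙 (mixed p) + 𝟙 (mixed q)) + sum (λ q → 𝟙 (crossing p q) + 𝟙 (crossing q p)))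
      ≡⟨ ∑-distrib-+ (λ p → sum (λ q → 𝟙 (mixed p) + 𝟙 (mixed q))) (λ p → sum (λ q → 𝟙 (crossing p q) + 𝟙 (crossing q p))) ⟩
    sum (λ p → sum (λ q → 𝟙 (mixed p) + 𝟙 (mixed q))) + sum (λ p → sum (λ q → 𝟙 (crossing p q) + 𝟙 (crossing q p)))
      ≡⟨ cong₂ _+_ (∑∑-distrib-+ (λ p q → 𝟙 (mixed p)) (λ p q → 𝟙 (mixed q)))
                   (∑∑-distrib-+ (λ p q → 𝟙 (crossing p q)) (λ p q → 𝟙 (crossing q p))) ⟩
    (sum (λ p → sum {t} (λ q → 𝟙 (mixed p))) + sum {t} (λ p → sum (λ q → 𝟙 (mixed q)))) +
    (sum (λ p → sum (λ q → 𝟙 (crossing p q))) + sum (λ p → sum (λ q → 𝟙 (crossing q p))))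
      ≤⟨ +-mono-≤ (+-mono-≤ (≤-trans (≤-reflexive (∑-comm {t} {t} (λ p q → 𝟙 (mixed p))))
                                     (sum≤n*c {t} 2 (λ _ → sum-mixed)))
                            (sum≤n*c {t} 2 (λ _ → sum-mixed)))
                  (+-mono-≤ (sum-staircase crossing? crossing-staircase)
                            (≤-trans (≤-reflexive (∑-comm {t} {t} (λ p q → 𝟙 (crossing q p))))
                                     (sum-staircase crossing? crossing-staircase))) ⟩
    (t * 2 + t * 2) + ((t + t) + (t + t))
      ≡⟨ arithmetic t ⟩
    t * 8 ∎
    where
    open ≤-Reasoning
    arithmetic : ∀ t → (t * 2 + t * 2) + ((t + t) + (t + t)) ≡ t * 8
    arithmetic = solve-∀
    ∑∑-distrib-+ : (g h : Fin t → Fin t → ℕ) →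
      sum (λ p → sum λ q → g p q + h p q) ≡ sum (λ p → sum (g p)) + sum (λ p → sum (h p))
    ∑∑-distrib-+ g h = trans (sum-cong-≗ λ p → ∑-distrib-+ (g p) (h p))
                             (∑-distrib-+ (λ p → sum (g p)) (λ p → sum (h p)))
    bound : ∀ p q → 𝟙 (does (p Fin.<? q) ∧ irregular p q)
                    ≤ (𝟙 (mixed p) + 𝟙 (mixed q)) + (𝟙 (crossing p q) + 𝟙 (crossing q p))
    bound p q = ≤-trans (𝟙-∧-≤ʳ (does (p Fin.<? q)) (irregular p q))
      (≤-trans (𝟙-∧-≤ʳ (p ≠ᵇ q) ((mixed p ∨ mixed q) ∨ (crossing p q ∨ crossing q p)))
      (≤-trans (𝟙-∨-≤ (mixed p ∨ mixed q) (crossing p q ∨ crossing q p))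
               (+-mono-≤ (𝟙-∨-≤ (mixed p) (mixed q)) (𝟙-∨-≤ (crossing p q) (crossing q p)))))

  Pure : Fin t → Set
  Pure p = ¬ Mixed isA p × ¬ Mixed notC p

  regular⁻ : ∀ {p q} → p ≢ q → irregular p q ≡ false →
             (Pure p × Pure q) × (¬ Crossing p q × ¬ Crossing q p)
  regular⁻ {p} {q} p≢q reg rewrite ≠ᵇ-true p≢q with ∨-false (mixed p ∨ mixed q) reg
  ... | ¬mix , ¬cross with ∨-false (mixed p) ¬mix | ∨-false (crossing p q) ¬cross
  ... | ¬mp , ¬mq | ¬pq , ¬qp =
    (pure p ¬mp , pure q ¬mq) , dec-false⁻¹ (crossing? p q) ¬pq , dec-false⁻¹ (crossing? q p) ¬qp
    where
    pure : ∀ p → mixed p ≡ false → Pure p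
    pure p ¬m with ∨-false (does (mixed? isA p)) ¬m
    ... | ¬a , ¬c = dec-false⁻¹ (mixed? isA p) ¬a , dec-false⁻¹ (mixed? notC p) ¬c

  -- By `inc≡link` there are two factors to control. Purity of `r` fixes the second; purity of `p`
  -- and `q` fixes the classes in the first, and then a change of `link` would be a crossing.
  inc-constant : ∀ {p q r} → Pure p → Pure q → Pure r → ¬ Crossing p q →
    ∀ {x x′ y y′ z z′} → x ∈ₚ p → x′ ∈ₚ p → y ∈ₚ q → y′ ∈ₚ q → z ∈ₚ r → z′ ∈ₚ r →
    inc (f x) (f y) (f z) ≡ inc (f x′) (f y′) (f z′)
  inc-constant (Ap , _) (Aq , Cq) (_ , Cr) ¬cross {x} {x′} {y} {y′} {z} {z′} x∈p x′∈p y∈q y′∈q z∈r z′∈r = begin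
    inc (f x) (f y) (f z)                    ≡⟨ inc≡link (f x) (f y) (f z) ⟩
    link (f x) (f y) ∧ not (notC (f z))      ≡⟨ cong₂ _∧_ link≡ (cong not (unmixed {notC} Cr z∈r z′∈r)) ⟩
    link (f x′) (f y′) ∧ not (notC (f z′))   ≡⟨ inc≡link (f x′) (f y′) (f z′) ⟨
    inc (f x′) (f y′) (f z′)                 ∎
    where
    open ≡-Reasoning
    link≡ : link (f x) (f y) ≡ link (f x′) (f y′)
    link≡ = ≡-from-⇔
      (link-transfer (f x) (f x′) (f y) (f y′)
        (unmixed {isA} Ap x∈p x′∈p) (unmixed {isA} Aq y∈q y′∈q) (unmixed {notC} Cq y∈q y′∈q)
        λ l g → ¬cross (x , x′ , y , y′ , x∈p , x′∈p , y∈q , y′∈q , l , g))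
      (link-transfer (f x′) (f x) (f y′) (f y)
        (unmixed {isA} Ap x′∈p x∈p) (unmixed {isA} Aq y′∈q y∈q) (unmixed {notC} Cq y′∈q y∈q)
        λ l g → ¬cross (x′ , x , y′ , y , x′∈p , x∈p , y′∈q , y∈q , l , g))

  -- An edge of `𝒱` is a disjunction of six `inc` terms, in which each ordered pair of the three
  -- parts supplies the a and the b once. Hence all six non-crossing conditions are consumed.
  edge-constant : ∀ {p q r} → p ≢ q → q ≢ r → p ≢ r →
    irregular p q ≡ false → irregular q r ≡ false → irregular p r ≡ false →
    ∀ {x x′ y y′ z z′} → x ∈ₚ p → x′ ∈ₚ p → y ∈ₚ q → y′ ∈ₚ q → z ∈ₚ r → z′ ∈ₚ r →
    edge 𝒱 (f x) (f y) (f z) ≡ edge 𝒱 (f x′) (f y′) (f z′)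
  edge-constant p≢q q≢r p≢r pq qr pr x x′ y y′ z z′
    with regular⁻ p≢q pq | regular⁻ q≢r qr | regular⁻ p≢r pr
  ... | (P , Q) , ¬pq , ¬qp | (_ , R) , ¬qr , ¬rq | _ , ¬pr , ¬rp =
    cong₂ _∨_ (inc-constant P Q R ¬pq x x′ y y′ z z′) $
    cong₂ _∨_ (inc-constant P R Q ¬pr x x′ z z′ y y′) $
    cong₂ _∨_ (inc-constant Q P R ¬qp y y′ x x′ z z′) $
    cong₂ _∨_ (inc-constant Q R P ¬qr y y′ z z′ x x′) $
    cong₂ _∨_ (inc-constant R P Q ¬rp z z′ x x′ y y′) $
               inc-constant R Q P ¬rq z z′ y y′ x x′

  irregular-free⇒Vdisc₃ : (H : ThreeGraph (Fin n)) →
    (∀ x y z → edge H x y z ≡ edge 𝒱 (f x) (f y) (f z)) →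
    ∀ {ε} → 0ℚ ℚ.≤ ε → ∀ p q r → p ≢ q → q ≢ r → p ≢ r →
    irregular p q ≡ false → irregular q r ≡ false → irregular p r ≡ false →
    Vdisc₃ ε (part E p) (part E q) (part E r) (H ∩ K₃ (part E p) (part E q) (part E r))
  irregular-free⇒Vdisc₃ H edge≡ 0≤ε p q r p≢q q≢r p≢r pq qr pr =
    homogeneous⇒Vdisc₃ 0≤ε H (edge H (element p) (element q) (element r))
      -- The common truth value is read off at one chosen vertex of each part.
      {part E p} {part E q} {part E r}
      (part-disjoint E p≢q) (part-disjoint E q≢r) (part-disjoint E p≢r)
      λ {x} {y} {z} x∈p y∈q z∈r → trans (edge≡ x y z) (trans
        (edge-constant p≢q q≢r p≢r pq qr pr x∈p (element∈ p) y∈q (element∈ q) z∈r (element∈ r))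
        (sym (edge≡ (element p) (element q) (element r))))
    where
    element : Fin t → Fin n
    element p = proj₁ (nonempty E p)
    element∈ : ∀ p → element p ∈ₚ p
    element∈ p = []=⇒lookup (proj₂ (nonempty E p))

-- One partition serves every `ε`, because the remaining triples have discrepancy 0; `ε` only
-- decides how large `t` must be for `t * 8` pairs to be few.
VdiscPartition : ∀ {n} → ℕ → ThreeGraph (Fin n) → Set
VdiscPartition {n} t H = Σ (Equipartition n t) λ E → Σ (PairSet (Fin t)) λ S → ∥ S ∥₂ ≤ t * 8 ×
  (∀ {ε} → 0ℚ ℚ.≤ ε → ∀ p q r → p ≢ q → q ≢ r → p ≢ r →
   pair S p q ≡ false → pair S q r ≡ false → pair S p r ≡ false →
   Vdisc₃ ε (part E p) (part E q) (part E r) (H ∩ K₃ (part E p) (part E q) (part E r)))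

vdiscPartition : ∀ {n t} .{{_ : NonZero t}} → t ≤ n → (H : ThreeGraph (Fin n)) → member ℋ𝒱 H →
  VdiscPartition t H
-- The sum of all indices serves as an upper bound for each of them; `code` needs a strict bound and
-- therefore receives `suc M`.
vdiscPartition {n} {t} t≤n H (inj , edge≡) = bySorting (sum (index ∘ f)) (term≤sum (index ∘ f))
  where
  f = Injection.to inj
  bySorting : ∀ M → (∀ v → index (f v) ≤ M) → VdiscPartition t H
  bySorting M f≤M = fromSorted (sortedEquipartition {t = t} code∘f-injective t≤n)
    where
    code∘f-injective : Injective _≡_ _≡_ (code (suc M) ∘ f)
    code∘f-injective {u} {v} e =
      Injection.injective inj (code-injective (f u) (f v) (s≤s (f≤M u)) (s≤s (f≤M v)) e)
    fromSorted : (Σ (Equipartition n t) λ E → ∀ {p q u v} → p Fin.< q →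
      lookup (part E p) u ≡ true → lookup (part E q) v ≡ true → code (suc M) (f u) < code (suc M) (f v)) →
      VdiscPartition t H
    fromSorted (E , sorted) = E , Σ-pairs , ∥Σ-pairs∥₂ , irregular-free⇒Vdisc₃ H edge≡
      where open Parts f (λ v → s≤s (f≤M v)) E sorted

-- ε > 0 has numerator at least 1, so 8 t ≤ ε t² as soon as t is at least 8 times the denominator.
linear≤ε*square : ∀ a d .(c : Coprime (suc a) (suc d)) {s t} → 8 * suc d ≤ t → s ≤ t * 8 →
  ℕ→ℚ s ℚ.≤ mkℚ (ℤ.+ suc a) d c ℚ.* ℕ→ℚ (t ^ 2)
linear≤ε*square a d c {s} {t} 8d≤t s≤8t = scaled-≤⁺ (suc a) d c s (t ^ 2) (begin
  s * suc d        ≤⟨ *-monoˡ-≤ (suc d) s≤8t ⟩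
  t * 8 * suc d    ≡⟨ *-assoc t 8 (suc d) ⟩
  t * (8 * suc d)  ≤⟨ *-monoʳ-≤ t 8d≤t ⟩
  t * t            ≡⟨ cong (t *_) (*-identityʳ t) ⟨
  t ^ 2            ≤⟨ m≤m+n (t ^ 2) (a * t ^ 2) ⟩
  suc a * t ^ 2    ∎)
  where open ≤-Reasoning

admitsBinaryVdisc₃Error : AdmitsBinaryVdisc₃Error ℋ𝒱
-- The number of parts is the same for all large `H`, so `t` is both the bound on it and the least
-- admissible number of vertices.
admitsBinaryVdisc₃Error ε@(mkℚ (ℤ.+ suc a) d c) 0<ε t₀ 1≤t₀ = t , t , λ H H∈ℋ𝒱 t≤n →
  let E , S , few , regular = vdiscPartition {{>-nonZero (≤-trans 1≤t₀ (m≤m+n t₀ _))}} t≤n H H∈ℋ𝒱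
  in t , m≤m+n t₀ _ , ≤-refl , E , S ,
     linear≤ε*square a d c (m≤n+m (8 * suc d) t₀) few , regular (ℚₚ.<⇒≤ 0<ε)
  where
  -- The first summand secures `t₀ ≤ t`, the second makes `8 t ≤ ε t²`.
  t = t₀ + 8 * suc d
admitsBinaryVdisc₃Error (mkℚ (ℤ.+ zero) d c) (ℚ.*<* (ℤ.+<+ ()))
admitsBinaryVdisc₃Error (mkℚ ℤ.-[1+ a ] d c) (ℚ.*<* ())

-- Distance from slicewise stable 3-graphs

sum-↑ : ∀ m {n} (f : Fin (m + n) → ℕ) → sum f ≡ sum (λ i → f (i ↑ˡ n)) + sum (λ j → f (m ↑ʳ j))
sum-↑ zero    f = refl
sum-↑ (suc m) f = trans (cong (f zero +_) (sum-↑ m (f ∘ suc))) (sym (+-assoc (f zero) _ _))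

sum-↑ˡ-≤ : ∀ m {n} (f : Fin (m + n) → ℕ) → sum (λ i → f (i ↑ˡ n)) ≤ sum f
sum-↑ˡ-≤ m f = ≤-trans (m≤m+n _ _) (≤-reflexive (sym (sum-↑ m f)))

sum-↑ʳ-≤ : ∀ m {n} (f : Fin (m + n) → ℕ) → sum (λ j → f (m ↑ʳ j)) ≤ sum f
sum-↑ʳ-≤ m f = ≤-trans (m≤n+m _ _) (≤-reflexive (sym (sum-↑ m f)))

sum-combine : ∀ m n (f : Fin (m * n) → ℕ) → sum f ≡ sum {m} (λ i → sum {n} λ j → f (combine i j))
sum-combine zero    n f = refl
sum-combine (suc m) n f = trans (sum-↑ n f) (cong (sum (λ j → f (j ↑ˡ (m * n))) +_) (sum-combine m n (λ i → f (n ↑ʳ i))))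

-- Each index is uniquely a block `i` with an offset inside it. Grouping the pairs of indices by
-- their offsets `s`, `t` gives `L * L` disjoint groups, each contributing at least `c`.
∑∑-blocks : ∀ B L {c} (g : Fin (B * L) → Fin (B * L) → ℕ) →
  (∀ s t → c ≤ sum {B} λ i → sum {B} λ j → g (combine i s) (combine j t)) →
  L * (L * c) ≤ sum λ x → sum (g x)
∑∑-blocks B L {c} g bound = begin
  L * (L * c)
    ≤⟨ n*c≤sum (L * c) (λ s → n*c≤sum c (bound s)) ⟩
  sum {L} (λ s → sum {L} λ t → sum {B} λ i → sum {B} λ j → g (combine i s) (combine j t))
    ≡⟨ sum-cong-≗ {L} (λ s → ∑-comm {L} {B} (λ t i → sum {B} λ j → g (combine i s) (combine j t))) ⟩
  sum {L} (λ s → sum {B} λ i → sum {L} λ t → sum {B} λ j → g (combine i s) (combine j t))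
    ≡⟨ sum-cong-≗ {L} (λ s → sum-cong-≗ {B} λ i → ∑-comm {L} {B} (λ t j → g (combine i s) (combine j t))) ⟩
  sum {L} (λ s → sum {B} λ i → sum {B} λ j → sum {L} λ t → g (combine i s) (combine j t))
    ≡⟨ sum-cong-≗ {L} (λ s → sum-cong-≗ {B} λ i → sum-combine B L (g (combine i s))) ⟨
  sum {L} (λ s → sum {B} λ i → sum (g (combine i s)))
    ≡⟨ ∑-comm {L} {B} (λ s i → sum (g (combine i s))) ⟩
  sum {B} (λ i → sum {L} λ s → sum (g (combine i s)))
    ≡⟨ sum-combine B L (λ x → sum (g x)) ⟨
  sum (λ x → sum (g x)) ∎
  where open ≤-Reasoning

pullback : (V → W) → ThreeGraph W → ThreeGraph V
pullback f G .edge x y z    = edge G (f x) (f y) (f z)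
pullback f G .edge-12 x y z = edge-12 G (f x) (f y) (f z)
pullback f G .edge-23 x y z = edge-23 G (f x) (f y) (f z)
pullback f G .edge-xxz x z  = edge-xxz G (f x) (f z)

splitAt-injective : ∀ m → Injective _≡_ _≡_ (splitAt m {n})
splitAt-injective m {u} {v} e =
  trans (sym (Finₚ.join-splitAt m _ u)) (trans (cong (join m _) e) (Finₚ.join-splitAt m _ v))

-- Finite segments of `𝒱`

module Segment (K L : ℕ) where

  vertex⊎ : Fin K ⊎ (Fin K ⊎ Fin L) → 𝒱-Vertex
  vertex⊎ (inj₁ x)        = a[ toℕ x ]
  vertex⊎ (inj₂ (inj₁ y)) = b[ toℕ y ]
  vertex⊎ (inj₂ (inj₂ z)) = c[ toℕ z ]

  split : Fin (K + (K + L)) → Fin K ⊎ (Fin K ⊎ Fin L)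
  split v = map₂ (splitAt K) (splitAt K v)

  vertex : Fin (K + (K + L)) → 𝒱-Vertex
  vertex = vertex⊎ ∘ split

  segment : ThreeGraph (Fin (K + (K + L)))
  segment = pullback vertex 𝒱

  vertex⊎-injective : Injective _≡_ _≡_ vertex⊎
  vertex⊎-injective {inj₁ x}        {inj₁ y}        e = cong inj₁ (Finₚ.toℕ-injective (cong index e))
  vertex⊎-injective {inj₂ (inj₁ x)} {inj₂ (inj₁ y)} e = cong (inj₂ ∘ inj₁) (Finₚ.toℕ-injective (cong index e))
  vertex⊎-injective {inj₂ (inj₂ x)} {inj₂ (inj₂ y)} e = cong (inj₂ ∘ inj₂) (Finₚ.toℕ-injective (cong index e))
  vertex⊎-injective {inj₁ _}        {inj₂ (inj₁ _)} ()
  vertex⊎-injective {inj₁ _}        {inj₂ (inj₂ _)} ()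
  vertex⊎-injective {inj₂ (inj₁ _)} {inj₁ _}        ()
  vertex⊎-injective {inj₂ (inj₂ _)} {inj₁ _}        ()
  vertex⊎-injective {inj₂ (inj₁ _)} {inj₂ (inj₂ _)} ()
  vertex⊎-injective {inj₂ (inj₂ _)} {inj₂ (inj₁ _)} ()

  split-injective : Injective _≡_ _≡_ split
  split-injective {u} {v} e with splitAt K u in eu | splitAt K v in ev
  ... | inj₁ x | inj₁ y = splitAt-injective K (trans eu (trans (cong inj₁ (inj₁-injective e)) (sym ev)))
  ... | inj₂ x | inj₂ y = splitAt-injective K
    (trans eu (trans (cong inj₂ (splitAt-injective K (inj₂-injective e))) (sym ev)))

  segment-member : member ℋ𝒱 segment
  segment-member = mk↣ (split-injective ∘ vertex⊎-injective) , λ x y z → refl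

  a-vertex b-vertex : Fin K → Fin (K + (K + L))
  a-vertex x = x ↑ˡ (K + L)
  b-vertex y = K ↑ʳ (y ↑ˡ L)

  c-vertex : Fin L → Fin (K + (K + L))
  c-vertex z = K ↑ʳ (K ↑ʳ z)

  vertex-a : ∀ x → vertex (a-vertex x) ≡ a[ toℕ x ]
  vertex-a x rewrite Finₚ.splitAt-↑ˡ K x (K + L) = refl

  vertex-b : ∀ y → vertex (b-vertex y) ≡ b[ toℕ y ]
  vertex-b y rewrite Finₚ.splitAt-↑ʳ K (K + L) (y ↑ˡ L) | Finₚ.splitAt-↑ˡ K y L = refl

  vertex-c : ∀ z → vertex (c-vertex z) ≡ c[ toℕ z ]
  vertex-c z rewrite Finₚ.splitAt-↑ʳ K (K + L) (K ↑ʳ z) | Finₚ.splitAt-↑ʳ K L z = refl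

  segment-edge : ∀ x y z → edge segment (a-vertex x) (b-vertex y) (c-vertex z) ≡ (toℕ x ≤ᵇ toℕ y)
  segment-edge x y z rewrite vertex-a x | vertex-b y | vertex-c z = ∨-identityʳ _

  a<b : ∀ x y → a-vertex x Fin.< b-vertex y
  a<b x y rewrite Finₚ.toℕ-↑ˡ x (K + L) | Finₚ.toℕ-↑ʳ K (y ↑ˡ L) = ≤-trans (Finₚ.toℕ<n x) (m≤m+n K _)

  b<c : ∀ y z → b-vertex y Fin.< c-vertex z
  b<c y z rewrite Finₚ.toℕ-↑ʳ K (y ↑ˡ L) | Finₚ.toℕ-↑ˡ y L | Finₚ.toℕ-↑ʳ K (K ↑ʳ z) | Finₚ.toℕ-↑ʳ K z =
    +-monoʳ-< K (≤-trans (Finₚ.toℕ<n y) (m≤m+n K _))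

  -- The a's are numbered before the b's and these before the c's, so every such triple is already
  -- in the increasing order that `∥_∥` counts. The sum over the c's is outermost because
  -- differences are later found slice by slice.
  ∑abc≤∥∥ : (G : ThreeGraph (Fin (K + (K + L)))) →
    sum (λ z → sum λ x → sum λ y → 𝟙 (edge G (a-vertex x) (b-vertex y) (c-vertex z))) ≤ ∥ G ∥
  ∑abc≤∥∥ G = begin
    sum (λ z → sum λ x → sum λ y → 𝟙 (edge G (a-vertex x) (b-vertex y) (c-vertex z)))
      ≡⟨ ∑-comm (λ z x → sum λ y → 𝟙 (edge G (a-vertex x) (b-vertex y) (c-vertex z))) ⟩
    sum (λ x → sum λ z → sum λ y → 𝟙 (edge G (a-vertex x) (b-vertex y) (c-vertex z)))
      ≡⟨ sum-cong-≗ (λ x → ∑-comm (λ z y → 𝟙 (edge G (a-vertex x) (b-vertex y) (c-vertex z)))) ⟩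
    sum (λ x → sum λ y → sum λ z → 𝟙 (edge G (a-vertex x) (b-vertex y) (c-vertex z)))
      ≡⟨ sum-cong-≗ (λ x → sum-cong-≗ λ y → sum-cong-≗ λ z → increasing-abc x y z) ⟩
    sum (λ x → sum λ y → sum λ z → count (a-vertex x) (b-vertex y) (c-vertex z))
      ≤⟨ sum-mono-≤ (λ x → sum-mono-≤ λ y →
           ≤-trans (sum-↑ʳ-≤ K (λ w → count (a-vertex x) (b-vertex y) (K ↑ʳ w)))
                   (sum-↑ʳ-≤ K (count (a-vertex x) (b-vertex y)))) ⟩
    sum (λ x → sum λ y → sum (count (a-vertex x) (b-vertex y)))
      ≤⟨ sum-mono-≤ (λ x →
           ≤-trans (sum-↑ˡ-≤ K (λ w → sum (count (a-vertex x) (K ↑ʳ w))))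
                   (sum-↑ʳ-≤ K (λ w → sum (count (a-vertex x) w)))) ⟩
    sum (λ x → sum λ w → sum (count (a-vertex x) w))
      ≤⟨ sum-↑ˡ-≤ K (λ w → sum λ w′ → sum (count w w′)) ⟩
    ∥ G ∥ ∎
    where
    open ≤-Reasoning
    count : Fin (K + (K + L)) → Fin (K + (K + L)) → Fin (K + (K + L)) → ℕ
    count x y z = 𝟙 (does (x Fin.<? y) ∧ does (y Fin.<? z) ∧ edge G x y z)
    increasing-abc : ∀ x y z → 𝟙 (edge G (a-vertex x) (b-vertex y) (c-vertex z))
                               ≡ count (a-vertex x) (b-vertex y) (c-vertex z)
    increasing-abc x y z
      rewrite dec-true (a-vertex x Fin.<? b-vertex y) (a<b x y)
            | dec-true (b-vertex y Fin.<? c-vertex z) (b<c y z) = refl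

-- Half graphs inside a segment

xor-false : ∀ p q → p xor q ≡ false → p ≡ q
xor-false true  true  _ = refl
xor-false false false _ = refl

𝟙≤0⇒false : ∀ {p} → 𝟙 p ≤ 0 → p ≡ false
𝟙≤0⇒false {false} _ = refl

module _ {k L : ℕ} (s t : Fin L) where

  -- The positions `2 i L + s` and `(2 j + 1) L + t`.
  even-block odd-block : Fin k → Fin (k * 2 * L)
  even-block i = combine (combine i (# 0)) s
  odd-block  j = combine (combine j (# 1)) t

  -- Block `2 i` precedes block `2 j + 1` exactly when `i ≤ j`. The parities keep the two blocks
  -- distinct, so the order of the blocks decides whatever the offsets are.
  blocks-half-graph : ∀ i j → T (toℕ (even-block i) ≤ᵇ toℕ (odd-block j)) ⇔ i Fin.≤ j
  blocks-half-graph i j = mk⇔ to from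
    where
    even : Fin k → Fin (k * 2)
    even i = combine i (# 0)
    odd : Fin k → Fin (k * 2)
    odd j = combine j (# 1)
    even<odd : i Fin.≤ j → even i Fin.< odd j
    even<odd i≤j with m≤n⇒m<n∨m≡n i≤j
    ... | inj₁ i<j = Finₚ.combine-monoˡ-< (# 0) (# 1) i<j
    ... | inj₂ i≡j
      rewrite Finₚ.toℕ-injective i≡j | Finₚ.toℕ-combine {n = 2} j (# 0) | Finₚ.toℕ-combine {n = 2} j (# 1) =
      +-monoʳ-< (2 * toℕ j) (s≤s z≤n)
    to : T (toℕ (even-block i) ≤ᵇ toℕ (odd-block j)) → i Fin.≤ j
    to e≤o = ≮⇒≥ λ j<i → ≤⇒≯ (≤ᵇ⇒≤ _ _ e≤o)
      (Finₚ.combine-monoˡ-< t s (Finₚ.combine-monoˡ-< (# 1) (# 0) j<i))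
    from : i Fin.≤ j → T (toℕ (even-block i) ≤ᵇ toℕ (odd-block j))
    from i≤j = ≤⇒≤ᵇ (<⇒≤ (Finₚ.combine-monoˡ-< s t (even<odd i≤j)))

stable-far-from-segment : ∀ k L → let open Segment (k * 2 * L) L in
  (G : ThreeGraph (Fin (k * 2 * L + (k * 2 * L + L)))) → SlicewiseStableGraph k G →
  L ^ 3 ≤ ∥ segment △ G ∥
stable-far-from-segment k L G stable = ≤-trans
  -- At least one difference for each pair of offsets gives `L * (L * 1)` in each of the `L` slices.
  (n*c≤sum (L * (L * 1)) λ z → ∑∑-blocks (k * 2) L (λ x y → 𝟙 (difference x y z)) λ s t → n≢0⇒n>0 (differ s t z))
  (∑abc≤∥∥ (segment △ G))
  where
  open Segment (k * 2 * L) L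
  difference : Fin (k * 2 * L) → Fin (k * 2 * L) → Fin L → Bool
  difference x y z = edge (segment △ G) (a-vertex x) (b-vertex y) (c-vertex z)
  differ : ∀ s t z → sum {k * 2} (λ i → sum {k * 2} λ j → 𝟙 (difference (combine i s) (combine j t) z)) ≢ 0
  differ s t z ∑≡0 = stable
    -- The vertex fixed in the definition of stability is a c here; the a's and b's form the two
    -- sides of the half graph.
    (c-vertex z , a-vertex ∘ even-block s t , b-vertex ∘ odd-block s t , λ i j →
      subst (λ e → T e ⇔ i Fin.≤ j) (sym (half-graph i j)) (blocks-half-graph s t i j))
    where
    agree : ∀ (i j : Fin (k * 2)) → difference (combine i s) (combine j t) z ≡ false
    agree i j = 𝟙≤0⇒false (≤-trans (term≤sum (λ j → 𝟙 (difference (combine i s) (combine j t) z)) j)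
      (≤-trans (term≤sum (λ i → sum {k * 2} λ j → 𝟙 (difference (combine i s) (combine j t) z)) i) (≤-reflexive ∑≡0)))
    half-graph : ∀ i j → edge G (c-vertex z) (a-vertex (even-block s t i)) (b-vertex (odd-block s t j))
                    ≡ (toℕ (even-block s t i) ≤ᵇ toℕ (odd-block s t j))
    half-graph i j = trans (edge-12 G _ _ _) (trans (edge-23 G _ _ _)
      (trans (sym (xor-false _ _ (agree (combine {k} {2} i (# 0)) (combine {k} {2} j (# 1)))))
             (segment-edge (even-block s t i) (odd-block s t j) z)))

-- Comparison of the difference with the cube of the number of vertices

cube-* : ∀ m n → (m * n) ^ 3 ≡ m ^ 3 * n ^ 3
cube-* = expanded
  where
  expanded : ∀ m n → m * n * (m * n * (m * n * 1)) ≡ m * (m * (m * 1)) * (n * (n * (n * 1)))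
  expanded = solve-∀

-- The segment with `2 k L` a's, `2 k L` b's and `L` c's has `width k * L` vertices.
width : ℕ → ℕ
width k = k * 2 + (k * 2 + 1)

size≡width*L : ∀ k L → k * 2 * L + (k * 2 * L + L) ≡ width k * L
size≡width*L k L = factor (k * 2) L
  where
  factor : ∀ B L → B * L + (B * L + L) ≡ (B + (B + 1)) * L
  factor = solve-∀

-- This is 1 / (D + 1) for D = (4k + 1)³, as `mkℚ` stores the denominator minus one. At least L³
-- differences among D L³ cubed vertices are a proportion of at least 1 / D, which exceeds it.
threshold : ℕ → ℚ
threshold k = mkℚ (ℤ.+ 1) (width k ^ 3) (1-coprimeTo (suc (width k ^ 3)))

stable-not-close : ∀ k L → 0 < L → let open Segment (k * 2 * L) L in
  (G : ThreeGraph (Fin (k * 2 * L + (k * 2 * L + L)))) → SlicewiseStableGraph k G →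
  ¬ Close (threshold k) segment G
stable-not-close k L 0<L G stable close = <⇒≱ large small
  where
  open Segment (k * 2 * L) L
  open ≤-Reasoning
  D = width k ^ 3
  vertices = k * 2 * L + (k * 2 * L + L)
  small : ∥ segment △ G ∥ * suc D ≤ D * L ^ 3
  small = begin
    ∥ segment △ G ∥ * suc D  ≤⟨ scaled-≤⁻ 1 D (1-coprimeTo (suc D)) ∥ segment △ G ∥ (vertices ^ 3) close ⟩
    1 * vertices ^ 3         ≡⟨ *-identityˡ (vertices ^ 3) ⟩
    vertices ^ 3             ≡⟨ cong (_^ 3) (size≡width*L k L) ⟩
    (width k * L) ^ 3        ≡⟨ cube-* (width k) L ⟩
    D * L ^ 3                ∎
  large : D * L ^ 3 < ∥ segment △ G ∥ * suc D
  large = begin-strict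
    D * L ^ 3                <⟨ m<n+m (D * L ^ 3) (m^n>0 L {{>-nonZero 0<L}} 3) ⟩
    suc D * L ^ 3            ≡⟨ *-comm (suc D) (L ^ 3) ⟩
    L ^ 3 * suc D            ≤⟨ *-monoˡ-≤ (suc D) (stable-far-from-segment k L G stable) ⟩
    ∥ segment △ G ∥ * suc D  ∎

0<threshold : ∀ k → 0ℚ ℚ.< threshold k
0<threshold k = ℚ.*<* (ℤ.+<+ (s≤s z≤n))

no-stable-approximation : ∀ {ℓ} (ℋ′ : HereditaryProperty ℓ) k →
  (∀ {n} (G : ThreeGraph (Fin n)) → member ℋ′ G → SlicewiseStableGraph k G) →
  ∀ N L → 0 < L → N ≤ L →
  ¬ (∀ {n} (G : ThreeGraph (Fin n)) → member ℋ𝒱 G → N ≤ n →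
     Σ (ThreeGraph (Fin n)) λ G′ → member ℋ′ G′ × Close (threshold k) G G′)
no-stable-approximation ℋ′ k stable N L 0<L N≤L approximate = refute (approximate segment segment-member N≤n)
  where
  open Segment (k * 2 * L) L
  N≤n : N ≤ k * 2 * L + (k * 2 * L + L)
  N≤n = ≤-trans N≤L (≤-trans (m≤n+m L (k * 2 * L)) (m≤n+m _ (k * 2 * L)))
  refute : ¬ (Σ (ThreeGraph (Fin _)) λ G → member ℋ′ G × Close (threshold k) segment G)
  refute (G , G∈ℋ′ , segment≈G) = stable-not-close k L 0<L G (stable G G∈ℋ′) segment≈G

farFromSlicewiseStable : ∀ ℓ → FarFromSlicewiseStable ℓ ℋ𝒱
farFromSlicewiseStable ℓ (ℋ′ , (k , stable) , close , _) with close (threshold k) (0<threshold k)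
-- Taking `L` to be `suc N` makes it positive and gives the segment at least `N` vertices.
... | N , approximate = no-stable-approximation ℋ′ k stable N (suc N) (s≤s z≤n) (n≤1+n N) approximate

proposition7p5 : ∀ ℓ → FarFromSlicewiseStable ℓ ℋ𝒱 × AdmitsBinaryVdisc₃Error ℋ𝒱
proposition7p5 ℓ = farFromSlicewiseStable ℓ , admitsBinaryVdisc₃Error
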